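{- Assume $\mathfrak p=\mathfrak c$. Let $\kappa$ be a cardinal with $\omega\leq\operatorname{cf}(\kappa)=\kappa\leq\mathfrak c$. Then there exists a nonprincipal ultrafilter $\mathcal U$ on $\omega$ such that $\langle\mathcal U,\supseteq^*\rangle\equiv_T\langle[\mathfrak c]^{<\kappa},\subseteq\rangle$.
   Context: A quasiorder is a set with a reflexive transitive relation $\leq$; it is directed if every finite subset has an upper bound in it. For directed sets $P,Q$, a map $f\colon P\to Q$ is Tukey if the $f$-image of every unbounded subset of $P$ is unbounded in $Q$; $P\leq_T Q$ means a Tukey map $P\to Q$ exists; $P\equiv_T Q$ means $P\leq_T Q\leq_T P$. $A\supseteq^* B$ means $B\setminus A$ is finite. $\langle\mathcal U,\supseteq^*\rangle$ denotes $\mathcal U$ quasiordered so that $A\leq B$ iff $A\supseteq^* B$. $\mathfrak c=2^{\aleph_0}$, and $[\mathfrak c]^{<\kappa}$ is the set of subsets of $\mathfrak c$ of size less than $\kappa$. A family $\mathcal A\subseteq\mathcal P(\omega)$ has the strong finite intersection property (SFIP) if $\bigcap\sigma$ is infinite for every finite $\sigma\subseteq\mathcal A$. A nontrivial pseudointersection of $\mathcal A$ is an infinite $b\subseteq\omega$ with $b\setminus a$ finite for all $a\in\mathcal A$. $\mathfrak p$ is the least cardinality of a family of infinite subsets of $\omega$ that has the SFIP but has no nontrivial pseudointersection. -}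

module Defs where

open import Data.Bool.Base using (Bool; true; false; T; not; _∧_)
open import Data.List.Base using (List; []; _∷_; _++_; all)
import Data.List.Membership.Propositional as List
open import Data.List.Membership.Propositional.Properties using (∈-++⁺ˡ; ∈-++⁺ʳ)
open import Data.List.Relation.Unary.All using (All)
open import Data.Nat.Base using (ℕ)
open import Data.Product.Base using (Σ; ∃; _×_; _,_; proj₁; proj₂)
open import Data.Sum.Base using (_⊎_)
open import Function.Base using (id)
open import Function.Bundles using (_↣_; _⤖_; _⇔_)
open import Level using (0ℓ; suc)
open import Relation.Binary.Bundles using (Preorder)
open import Relation.Binary.Core using (Rel)
open import Relation.Binary.Definitions using (Irrelevant)
open import Relation.Binary.PropositionalEquality.Core using (_≡_; refl)
open import Relation.Binary.PropositionalEquality.Properties using (isEquivalence)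
open import Relation.Binary.Structures using (IsStrictTotalOrder)
open import Relation.Nullary.Negation.Core using (¬_)
open import Relation.Unary using (Pred)
import Relation.Binary.Construct.StrictToNonStrict as StrictToNonStrict
open import Induction.WellFounded using (WellFounded)

-- Powersets are sets of characteristic functions, so that they stay in Set
-- and can be iterated.  Excluded middle, assumed wherever these are used,
-- makes every predicate arise from one of them, and function extensionality
-- makes _≡_ on 𝒫 X the equality of subsets.

𝒫 : Set → Set
𝒫 X = X → Bool

infix 4 _∈_ _⊆_

_∈_ : {X : Set} → X → 𝒫 X → Set
x ∈ A = T (A x)

_⊆_ : {X : Set} → 𝒫 X → 𝒫 X → Set
A ⊆ B = ∀ x → x ∈ A → x ∈ B

infixr 7 _∩_
infixl 7 _∖_

∅ : {X : Set} → 𝒫 X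
∅ _ = false

∁ : {X : Set} → 𝒫 X → 𝒫 X
∁ A x = not (A x)

_∩_ : {X : Set} → 𝒫 X → 𝒫 X → 𝒫 X
(A ∩ B) x = A x ∧ B x

_∖_ : {X : Set} → 𝒫 X → 𝒫 X → 𝒫 X
A ∖ B = A ∩ ∁ B

-- ⋂ [] is the whole of X.
⋂ : {X : Set} → List (𝒫 X) → 𝒫 X
⋂ σ x = all (λ A → A x) σ

-- Since T b has at most one element, this type has exactly one element for
-- each member of A.
Elements : {X : Set} → 𝒫 X → Set
Elements {X} A = Σ X (λ x → x ∈ A)

Finite : {X : Set} → 𝒫 X → Set
Finite A = ∃ λ xs → ∀ x → x ∈ A → x List.∈ xs

Infinite : {X : Set} → 𝒫 X → Set
Infinite A = ¬ Finite A

-- A cardinal is an initial ordinal: a well-ordered set that does not inject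
-- into any of its proper initial segments.  Irrelevance of _<_ makes
-- ∃ λ β → β < α the initial segment below α without repetitions.

record Cardinal : Set (suc 0ℓ) where
  infix 4 _<_
  field
    Carrier            : Set
    _<_                : Rel Carrier 0ℓ
    isStrictTotalOrder : IsStrictTotalOrder _≡_ _<_
    <-irrelevant       : Irrelevant _<_
    <-wellFounded      : WellFounded _<_
    initial            : ∀ α → ¬ (Carrier ↣ (∃ λ β → β < α))

  open StrictToNonStrict _≡_ _<_ public using (_≤_)

∣_∣ : Cardinal → Set
∣_∣ = Cardinal.Carrier

infix 4 _≺_

_≺_ : Set → Set → Set
X ≺ Y = (X ↣ Y) × ¬ (Y ↣ X)

IsLeastCardinality : {X : Set} → Pred (𝒫 X) 0ℓ → Cardinal → Set
IsLeastCardinality P μ =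
  (∃ λ A → P A × (Elements A ⤖ ∣ μ ∣)) × (∀ A → P A → ∣ μ ∣ ↣ Elements A)

Cofinal : (κ : Cardinal) → Pred (𝒫 ∣ κ ∣) 0ℓ
Cofinal κ D = ∀ α → ∃ λ β → β ∈ D × (α ≤ β)
  where open Cardinal κ

-- cf(κ) = μ
IsCofinality : Cardinal → Cardinal → Set
IsCofinality κ μ = IsLeastCardinality (Cofinal κ) μ

SFIP : Pred (𝒫 (𝒫 ℕ)) 0ℓ
SFIP 𝒜 = ∀ σ → All (_∈ 𝒜) σ → Infinite (⋂ σ)

NontrivialPseudointersection : 𝒫 (𝒫 ℕ) → Pred (𝒫 ℕ) 0ℓ
NontrivialPseudointersection 𝒜 b =
  Infinite b × (∀ a → a ∈ 𝒜 → Finite (b ∖ a))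

-- 𝔭 = μ
Is𝔭 : Cardinal → Set
Is𝔭 = IsLeastCardinality λ 𝒜 →
  (∀ a → a ∈ 𝒜 → Infinite a) × SFIP 𝒜 × ¬ ∃ (NontrivialPseudointersection 𝒜)

record IsUltrafilter (𝒰 : 𝒫 (𝒫 ℕ)) : Set where
  field
    ∅∉       : ¬ (∅ ∈ 𝒰)
    upward   : ∀ A B → A ⊆ B → A ∈ 𝒰 → B ∈ 𝒰
    ∩-closed : ∀ A B → A ∈ 𝒰 → B ∈ 𝒰 → A ∩ B ∈ 𝒰
    ultra    : ∀ A → A ∈ 𝒰 ⊎ ∁ A ∈ 𝒰

Nonprincipal : Pred (𝒫 (𝒫 ℕ)) 0ℓ
Nonprincipal 𝒰 = ¬ ∃ λ n → ∀ A → (A ∈ 𝒰 ⇔ n ∈ A)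

Quasiorder : Set (suc 0ℓ)
Quasiorder = Preorder 0ℓ 0ℓ 0ℓ

module _ (P : Quasiorder) where
  open Preorder P

  -- Finite subsets are given by lists; the empty list makes P nonempty.
  Directed : Set
  Directed = ∀ xs → ∃ λ u → All (_≲ u) xs

  Unbounded : Pred (Pred Carrier 0ℓ) 0ℓ
  Unbounded S = ¬ ∃ λ u → ∀ x → S x → x ≲ u

image : {X Y : Set} → (X → Y) → Pred X 0ℓ → Pred Y 0ℓ
image f S y = ∃ λ x → S x × f x ≡ y

IsTukey : (P Q : Quasiorder) → (Preorder.Carrier P → Preorder.Carrier Q) → Set (suc 0ℓ)
IsTukey P Q f = ∀ S → Unbounded P S → Unbounded Q (image f S)

infix 4 _≤T_ _≡T_

-- The Tukey ordering is only defined between directed sets.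
_≤T_ : Quasiorder → Quasiorder → Set (suc 0ℓ)
P ≤T Q = Directed P × Directed Q × ∃ (IsTukey P Q)

_≡T_ : Quasiorder → Quasiorder → Set (suc 0ℓ)
P ≡T Q = (P ≤T Q) × (Q ≤T P)

infix 4 _⊇*_

_⊇*_ : Rel (𝒫 ℕ) 0ℓ
A ⊇* B = Finite (B ∖ A)

⊇*-refl : ∀ A → A ⊇* A
⊇*-refl A = [] , λ x → absurd (A x)
  where
  absurd : ∀ b {R : Set} → T (b ∧ not b) → R
  absurd true  ()
  absurd false ()

⊇*-trans : ∀ A B C → A ⊇* B → B ⊇* C → A ⊇* C
⊇*-trans A B C (xs , p) (ys , q) = xs ++ ys , λ x → split x (A x) (B x) (C x) (p x) (q x)
  where
  split : ∀ x a b c → (T (b ∧ not a) → x List.∈ xs) → (T (c ∧ not b) → x List.∈ ys) →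
          T (c ∧ not a) → x List.∈ (xs ++ ys)
  split x false true  _    p q _ = ∈-++⁺ˡ (p _)
  split x false false true p q _ = ∈-++⁺ʳ xs (q _)
  split x true  b     true p q ()

⟨_,⊇*⟩ : 𝒫 (𝒫 ℕ) → Quasiorder
⟨ 𝒰 ,⊇*⟩ = record
  { Carrier    = Elements 𝒰
  ; _≈_        = _≡_
  ; _≲_        = λ A B → proj₁ A ⊇* proj₁ B
  ; isPreorder = record
    { isEquivalence = isEquivalence
    ; reflexive     = λ { {A , _} refl → ⊇*-refl A }
    ; trans         = λ { {A , _} {B , _} {C , _} → ⊇*-trans A B C }
    }
  }

-- A set s of size less than κ may occur several times as (s , _), but these
-- copies lie below each other, which does not affect Tukey types.
⟨[_]^<_,⊆⟩ : Cardinal → Cardinal → Quasiorder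
⟨[ μ ]^< κ ,⊆⟩ = record
  { Carrier    = Σ (𝒫 ∣ μ ∣) λ s → Elements s ≺ ∣ κ ∣
  ; _≈_        = _≡_
  ; _≲_        = λ s t → proj₁ s ⊆ proj₁ t
  ; isPreorder = record
    { isEquivalence = isEquivalence
    ; reflexive     = λ { refl x → id }
    ; trans         = λ s⊆t t⊆u x x∈s → t⊆u x (s⊆t x x∈s)
    }
  }

{-# OPTIONS --safe #-}
module Submission where

-- We build sets x_α and e_α ⊆ x_α (α < 𝔠) such that the e_α generate an
-- ultrafilter 𝒰 in which (a) every family of fewer than κ members has a lower
-- bound modulo finite sets, and (b) every member is almost contained in fewer
-- than κ of the x_α.  By (a) and (b), sending s to an almost lower bound of
-- {x_α ∣ α ∈ s} is a Tukey map [𝔠]^{<κ} → 𝒰, and by (a) any injection 𝒰 → 𝔠,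
-- read as a map to singletons, is a Tukey map in the other direction.
--
-- The recursion keeps (b) alive by requiring that for each finite intersection
-- of the e_β there are fewer than κ indices outside of which no finite union
-- of the x_β almost covers it.  At stage α, one family of fewer than κ sets is
-- given a pseudointersection if this is consistent with the requirement, the
-- α-th subset of ℕ is decided, and x_α is chosen to split all fewer than 𝔠
-- sets obtained so far.  Pseudointersections meeting fewer than 𝔠 prescribed
-- sets, and splitting sets, come from applying 𝔭 = 𝔠 to families of sets of
-- finite sequences.  Excluded middle, being about all types in Set, also
-- serves as the axiom of choice.

open import Defs
open import Axiom.ExcludedMiddle using (ExcludedMiddle)
open import Axiom.Extensionality.Propositional using (Extensionality)
open import Axiom.UniquenessOfIdentityProofs.WithK using (uip)
open import Data.Bool.Base using (Bool; true; false; T; not; if_then_else_)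
open import Data.Bool.Properties using (T-∧; T-irrelevant; T?)
open import Data.Empty using (⊥; ⊥-elim)
open import Data.List.Base using (List; []; _∷_; _++_; map; length; upTo; filter)
import Data.List.Membership.Propositional as List
open import Data.List.Membership.Propositional.Properties using (∈-upTo⁺; ∈-map⁺; ∈-map⁻; ∈-filter⁺; ∈-filter⁻)
open import Data.List.Relation.Unary.All using (All; []; _∷_; tabulate; lookup)
import Data.List.Relation.Unary.All as All
import Data.List.Relation.Unary.All.Properties as AllP
open import Data.List.Relation.Unary.Any using (Any; here; there)
open import Data.Nat.Base using (ℕ; zero; suc; _+_; _*_; _≤_; _<_; _⊔_; z≤n; s≤s)
import Data.Nat.Properties as ℕ
open import Data.Nat.ListAction using (sum)
open import Data.Product.Base using (Σ; ∃; _×_; _,_; proj₁; proj₂; uncurry)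
open import Data.Sum.Base using (_⊎_; inj₁; inj₂; [_,_]′)
open import Data.Unit.Base using (⊤; tt)
open import Data.Vec.Base using (Vec; []; _∷_; fromList; toList)
open import Data.Vec.Properties using (toList∘fromList)
open import Function.Base using (_∘_; id)
open import Function.Bundles using (_↣_; _⤖_; mk↣; module Injection; module Bijection; module Equivalence)
open import Function.Construct.Composition using (_↣-∘_)
open import Function.Construct.Symmetry using (↔-sym)
open import Function.Properties.Bijection using (⤖⇒↔)
open import Function.Properties.Inverse using (↔⇒↣)
open import Induction.WellFounded using (Acc; acc; module FixPoint)
open import Level using (0ℓ)
open import Relation.Binary.Bundles using (Preorder)
open import Relation.Binary.Definitions using (Tri; tri<; tri≈; tri>)
open import Relation.Binary.PropositionalEquality using (_≡_; refl; sym; trans; cong; cong₂; cong-app; subst)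
open import Relation.Binary.Structures using (IsStrictTotalOrder)
open import Relation.Nullary using (¬_; Dec; yes; no)
open import Relation.Nullary.Decidable using (⌊_⌋; toWitness; fromWitness)

open Injection using (to; injective)

-- Coding pairs and lists of natural numbers.

-- The value is 2^a (2k + 1).
pair : ℕ → ℕ → ℕ
pair zero    k = suc (2 * k)
pair (suc a) k = 2 * pair a k

pair-injective : ∀ a b {k l} → pair a k ≡ pair b l → a ≡ b × k ≡ l
pair-injective zero    zero    eq = refl , ℕ.*-cancelˡ-≡ _ _ 2 (ℕ.suc-injective eq)
pair-injective zero    (suc b) {k} {l} eq = ⊥-elim (ℕ.even≢odd (pair b l) k (sym eq))
pair-injective (suc a) zero    {k} {l} eq = ⊥-elim (ℕ.even≢odd (pair a k) l eq)
pair-injective (suc a) (suc b) eq with pair-injective a b (ℕ.*-cancelˡ-≡ _ _ 2 eq)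
... | refl , k≡l = refl , k≡l

m<pair : ∀ a k → a < pair a k
m<pair zero    k = s≤s z≤n
m<pair (suc a) k = ℕ.≤-trans (ℕ.+-mono-≤ (ℕ.≤-trans (s≤s z≤n) (m<pair a k)) (m<pair a k))
                     (ℕ.≤-reflexive (cong (pair a k +_) (sym (ℕ.+-identityʳ _))))

ℕ×ℕ↣ℕ : (ℕ × ℕ) ↣ ℕ
ℕ×ℕ↣ℕ = mk↣ {to = uncurry pair} λ {p} {q} eq →
  let a≡b , k≡l = pair-injective (proj₁ p) (proj₁ q) eq in
  cong₂ _,_ a≡b k≡l

encode : List ℕ → ℕ
encode []       = zero
encode (a ∷ as) = suc (pair a (encode as))

encode-injective : ∀ {as bs} → encode as ≡ encode bs → as ≡ bs
encode-injective {[]}     {[]}     eq = refl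
encode-injective {a ∷ as} {b ∷ bs} eq with pair-injective a b (ℕ.suc-injective eq)
... | refl , eq′ = cong (a ∷_) (encode-injective eq′)

Listℕ↣ℕ : List ℕ ↣ ℕ
Listℕ↣ℕ = mk↣ encode-injective

-- Injections between products and lists; Boolean subsets.

×-mono-↣ : {A B C D : Set} → A ↣ B → C ↣ D → (A × C) ↣ (B × D)
×-mono-↣ f g = mk↣ {to = λ (a , c) → to f a , to g c} λ eq →
  cong₂ _,_ (injective f (cong proj₁ eq)) (injective g (cong proj₂ eq))

Σ-irrelevant-≡ : {A : Set} {B : A → Set} → (∀ {a} (b b′ : B a) → b ≡ b′) →
                 {p q : Σ A B} → proj₁ p ≡ proj₁ q → p ≡ q
Σ-irrelevant-≡ irr {a , b} {.a , b′} refl = cong (a ,_) (irr b b′)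

Elements-≡ : {X : Set} {A : 𝒫 X} {p q : Elements A} → proj₁ p ≡ proj₁ q → p ≡ q
Elements-≡ = Σ-irrelevant-≡ T-irrelevant

-- Through this, closure under lists follows from closure under products and sums over ℕ.
List↣ΣVec : {X : Set} → List X ↣ Σ ℕ (Vec X)
List↣ΣVec {X} = mk↣ {to = λ xs → length xs , fromList xs} λ {xs} {ys} eq →
  trans (sym (toList∘fromList xs)) (trans (cong (toList ∘ proj₂) eq) (toList∘fromList ys))

∈-∩⁺ : {X : Set} (A B : 𝒫 X) {x : X} → x ∈ A → x ∈ B → x ∈ A ∩ B
∈-∩⁺ A B x∈A x∈B = Equivalence.from T-∧ (x∈A , x∈B)

∈-∩⁻ : {X : Set} (A B : 𝒫 X) {x : X} → x ∈ A ∩ B → x ∈ A × x ∈ B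
∈-∩⁻ A B = Equivalence.to T-∧

∈-∁⁺ : {X : Set} (A : 𝒫 X) {x : X} → ¬ x ∈ A → x ∈ ∁ A
∈-∁⁺ A {x} = aux (A x)
  where
  aux : ∀ b → ¬ T b → T (not b)
  aux true  ¬t = ⊥-elim (¬t tt)
  aux false ¬t = tt

∈-∁⁻ : {X : Set} (A : 𝒫 X) {x : X} → x ∈ ∁ A → ¬ x ∈ A
∈-∁⁻ A {x} = aux (A x)
  where
  aux : ∀ b → T (not b) → ¬ T b
  aux true  ()
  aux false _ ()

∈⇒≤sum : ∀ {m ns} → m List.∈ ns → m ≤ sum ns
∈⇒≤sum {ns = n ∷ ns} (here refl) = ℕ.m≤m+n n (sum ns)
∈⇒≤sum {ns = n ∷ ns} (there m∈)  = ℕ.≤-trans (∈⇒≤sum m∈) (ℕ.m≤n+m (sum ns) n)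

-- Infinitely often and eventually.

-- Positive forms of infinite and cofinite, for predicates that need not be Boolean-valued.
Inf : (ℕ → Set) → Set
Inf P = ∀ n → ∃ λ m → n ≤ m × P m

Ev : (ℕ → Set) → Set
Ev P = ∃ λ n → ∀ m → n ≤ m → P m

module _ {P Q : ℕ → Set} where

  Inf-map : (∀ m → P m → Q m) → Inf P → Inf Q
  Inf-map f inf n = let m , n≤m , p = inf n in m , n≤m , f m p

  Ev-map : (∀ m → P m → Q m) → Ev P → Ev Q
  Ev-map f (n , ev) = n , λ m n≤m → f m (ev m n≤m)

  Ev-× : Ev P → Ev Q → Ev (λ m → P m × Q m)
  Ev-× (n , p) (n′ , q) = n ⊔ n′ , λ m le →
    p m (ℕ.≤-trans (ℕ.m≤m⊔n n n′) le) , q m (ℕ.≤-trans (ℕ.m≤n⊔m n n′) le)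

  Inf-Ev : Inf P → Ev Q → Inf (λ m → P m × Q m)
  Inf-Ev inf (n , ev) k with inf (n ⊔ k)
  ... | m , le , p = m , ℕ.≤-trans (ℕ.m≤n⊔m n k) le , p , ev m (ℕ.≤-trans (ℕ.m≤m⊔n n k) le)

Ev-All : {X : Set} {P : X → ℕ → Set} (xs : List X) → (∀ x → Ev (P x)) →
         Ev (λ n → All (λ x → P x n) xs)
Ev-All []       ev = 0 , λ _ _ → []
Ev-All (x ∷ xs) ev = Ev-map (λ _ (p , ps) → p ∷ ps) (Ev-× (ev x) (Ev-All xs ev))

Ev-∉ : ∀ ns → Ev (λ m → ¬ m List.∈ ns)
Ev-∉ ns = suc (sum ns) , λ m lt m∈ → ℕ.<-irrefl refl (ℕ.≤-trans lt (∈⇒≤sum m∈))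

Inf⇒Infinite : {A : 𝒫 ℕ} → Inf (_∈ A) → Infinite A
Inf⇒Infinite inf (xs , p) with Inf-Ev inf (Ev-∉ xs) 0
... | m , _ , m∈A , m∉xs = m∉xs (p m m∈A)

⊇*⇒Ev : ∀ A B → A ⊇* B → Ev (λ m → m ∈ B → m ∈ A)
⊇*⇒Ev A B (xs , p) = Ev-map aux (Ev-∉ xs)
  where
  aux : ∀ m → ¬ m List.∈ xs → m ∈ B → m ∈ A
  aux m m∉xs m∈B with T? (A m)
  ... | yes m∈A = m∈A
  ... | no  m∉A = ⊥-elim (m∉xs (p m (∈-∩⁺ B (∁ A) m∈B (∈-∁⁺ A m∉A))))

Ev⇒⊇* : ∀ A B → Ev (λ m → m ∈ B → m ∈ A) → A ⊇* B
Ev⇒⊇* A B (n , ev) = upTo n , aux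
  where
  aux : ∀ m → m ∈ B ∖ A → m List.∈ upTo n
  aux m m∈ with ∈-∩⁻ B (∁ A) m∈ | ℕ.<-≤-connex m n
  ... | _         | inj₁ m<n = ∈-upTo⁺ m<n
  ... | m∈B , m∈∁ | inj₂ n≤m = ⊥-elim (∈-∁⁻ A m∈∁ (ev m n≤m m∈B))

-- Initial segments and directedness.

seg : (μ : Cardinal) → ∣ μ ∣ → Set
seg μ α = ∃ λ β → Cardinal._<_ μ β α

seg↣ : (μ : Cardinal) (α : ∣ μ ∣) → seg μ α ↣ ∣ μ ∣
seg↣ μ α = mk↣ {to = proj₁} (Σ-irrelevant-≡ (Cardinal.<-irrelevant μ))

binary⇒Directed : (P : Quasiorder) → Preorder.Carrier P →
                  (∀ a b → ∃ λ c → Preorder._≲_ P a c × Preorder._≲_ P b c) → Directed P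
binary⇒Directed P p₀ upper []       = p₀ , []
binary⇒Directed P p₀ upper (a ∷ as) with binary⇒Directed P p₀ upper as
... | b , as≲b with upper a b
... | c , a≲c , b≲c = c , a≲c ∷ All.map (λ a′≲b → Preorder.trans P a′≲b b≲c) as≲b

-- Comprehension, Cantor's theorem and transfinite recursion.

module Classical (em : ExcludedMiddle 0ℓ) (ext : Extensionality 0ℓ 0ℓ) where

  by-contradiction : {P : Set} → ¬ ¬ P → P
  by-contradiction {P} ¬¬p with em {P}
  ... | yes p = p
  ... | no ¬p = ⊥-elim (¬¬p ¬p)

  ⟦_⟧ : {X : Set} → (X → Set) → 𝒫 X
  ⟦ P ⟧ x = ⌊ em {P x} ⌋

  ∈⟦⟧⁺ : {X : Set} (P : X → Set) {x : X} → P x → x ∈ ⟦ P ⟧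
  ∈⟦⟧⁺ P = fromWitness

  ∈⟦⟧⁻ : {X : Set} (P : X → Set) {x : X} → x ∈ ⟦ P ⟧ → P x
  ∈⟦⟧⁻ P = toWitness

  Infinite⇒Inf : {A : 𝒫 ℕ} → Infinite A → Inf (_∈ A)
  Infinite⇒Inf {A} infinite n = by-contradiction λ none → infinite (upTo n , aux none)
    where
    aux : ¬ (∃ λ m → n ≤ m × m ∈ A) → ∀ m → m ∈ A → m List.∈ upTo n
    aux none m m∈A with ℕ.<-≤-connex m n
    ... | inj₁ m<n = ∈-upTo⁺ m<n
    ... | inj₂ n≤m = ⊥-elim (none (m , n≤m , m∈A))

  -- If `Q` does not hold infinitely often, it eventually fails, and from then on `P` forces `S`.
  Inf-⊎ : {P Q S : ℕ → Set} → (∀ m → P m → Q m ⊎ S m) → ¬ Inf Q → Inf P → Inf S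
  Inf-⊎ {P} {Q} {S} split ¬infQ infP = Inf-map (λ m (p , ¬q) → other m (split m p) ¬q) (Inf-Ev infP ev¬Q)
    where
    ev¬Q : Ev (λ m → ¬ Q m)
    ev¬Q = by-contradiction λ ¬ev → ¬infQ λ n → by-contradiction λ none →
      ¬ev (n , λ m n≤m q → none (m , n≤m , q))
    other : ∀ m → Q m ⊎ S m → ¬ Q m → S m
    other m (inj₁ q) ¬q = ⊥-elim (¬q q)
    other m (inj₂ s) ¬q = s

  𝒫-≡ : {X : Set} {A B : 𝒫 X} → A ⊆ B → B ⊆ A → A ≡ B
  𝒫-≡ {A = A} {B} A⊆B B⊆A = ext λ x → aux (A x) (B x) (A⊆B x) (B⊆A x)
    where
    aux : ∀ a b → (T a → T b) → (T b → T a) → a ≡ b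
    aux true  true  f g = refl
    aux true  false f g = ⊥-elim (f tt)
    aux false true  f g = ⊥-elim (g tt)
    aux false false f g = refl

  -- Diagonal argument on the set of all codes `to f A` that are not in `A`.
  cantor : {X : Set} → ¬ (𝒫 X ↣ X)
  cantor {X} f = d∉D (∈⟦⟧⁺ P (⟦ P ⟧ , refl , d∉D))
    where
    P : X → Set
    P x = ∃ λ A → to f A ≡ x × ¬ x ∈ A
    d∉D : ¬ to f ⟦ P ⟧ ∈ ⟦ P ⟧
    d∉D d∈D with ∈⟦⟧⁻ P d∈D
    ... | A , fA≡d , d∉A = d∉A (subst (to f ⟦ P ⟧ ∈_) (sym (injective f fA≡d)) d∈D)

  𝒫-mono : {X Y : Set} → X ↣ Y → 𝒫 X ↣ 𝒫 Y
  𝒫-mono {X} {Y} f = mk↣ {to = λ A → ⟦ direct A ⟧} λ eq → 𝒫-≡ (half eq) (half (sym eq))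
    where
    direct : 𝒫 X → Y → Set
    direct A y = ∃ λ x → to f x ≡ y × x ∈ A
    half : ∀ {A B} → ⟦ direct A ⟧ ≡ ⟦ direct B ⟧ → A ⊆ B
    half {A} {B} eq x x∈A with ∈⟦⟧⁻ (direct B) (subst (to f x ∈_) eq (∈⟦⟧⁺ (direct A) (x , refl , x∈A)))
    ... | x′ , fx′≡fx , x′∈B = subst (_∈ B) (injective f fx′≡fx) x′∈B

  -- Excluded middle fixes one preimage of each value, and `f` recovers the value from it.
  range-↣ : {X Y : Set} (f : X → Y) → Elements ⟦ (λ y → ∃ λ x → f x ≡ y) ⟧ ↣ X
  range-↣ f = mk↣ {to = λ (y , y∈) → proj₁ (∈⟦⟧⁻ InRange y∈)} λ { {y , y∈} {z , z∈} eq →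
    Elements-≡ (trans (sym (proj₂ (∈⟦⟧⁻ InRange y∈))) (trans (cong f eq) (proj₂ (∈⟦⟧⁻ InRange z∈)))) }
    where
    InRange = λ y → ∃ λ x → f x ≡ y

  recursion : (μ : Cardinal) {A : Set} (step : ∀ α → (seg μ α → A) → A) →
              ∃ λ (f : ∣ μ ∣ → A) → ∀ α → f α ≡ step α (f ∘ proj₁)
  recursion μ step = _ , λ α → F.unfold-wfRec {α}
    where
    module F = FixPoint (Cardinal.<-wellFounded μ) (λ _ → _)
      (λ α IH → step α (λ (β , β<α) → IH β<α)) (λ α eq → cong (step α) (ext λ (β , β<α) → eq β<α))

  -- Sets whose powerset embeds in 2^ω.

  sequences↣ : (ℕ → 𝒫 ℕ) ↣ 𝒫 ℕ
  sequences↣ = 𝒫-mono ℕ×ℕ↣ℕ ↣-∘ mk↣ {to = uncurry} λ eq → ext λ n → ext λ m → cong-app eq (n , m)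

  -- For X ↣ 𝒫 ℕ and 𝔭 = 𝔠 this amounts to X having size less than 𝔠, by
  -- `small` and `Small⇒¬↣` below.  In this form, closure under products and
  -- lists needs no arithmetic of infinite cardinals.
  Small : Set → Set
  Small X = 𝒫 X ↣ 𝒫 ℕ

  Small-↣ : {X Y : Set} → X ↣ Y → Small Y → Small X
  Small-↣ f s = s ↣-∘ 𝒫-mono f

  Small-ℕ : Small ℕ
  Small-ℕ = mk↣ id

  -- 2^(X×Y) = (2^Y)^X embeds in (2^ω)^X = (2^X)^ω, and this in (2^ω)^ω.
  Small-× : {X Y : Set} → Small X → Small Y → Small (X × Y)
  Small-× s t = sequences↣ ↣-∘ mk↣ {to = λ C n → to s λ x → to t (λ y → C (x , y)) n} λ eq →
    ext λ (x , y) → cong-app (injective t (ext λ n → cong-app (injective s (cong-app eq n)) x)) y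

  Small-Σℕ : {B : ℕ → Set} → (∀ n → Small (B n)) → Small (Σ ℕ B)
  Small-Σℕ s = sequences↣ ↣-∘ mk↣ {to = λ C n → to (s n) λ b → C (n , b)} λ eq →
    ext λ (n , b) → cong-app (injective (s n) (cong-app eq n)) b

  Small-⊤ : Small ⊤
  Small-⊤ = Small-↣ (mk↣ {to = λ _ → 0} λ _ → refl) Small-ℕ

  Small-⊎ : {X Y : Set} → Small X → Small Y → Small (X ⊎ Y)
  Small-⊎ {X} {Y} s t = Small-↣ (mk↣ into-injective) (Small-Σℕ small)
    where
    B : ℕ → Set
    B zero    = X
    B (suc _) = Y
    small : ∀ n → Small (B n)
    small zero    = s
    small (suc _) = t
    into : X ⊎ Y → Σ ℕ B
    into (inj₁ x) = 0 , x
    into (inj₂ y) = 1 , y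
    into-injective : ∀ {p q} → into p ≡ into q → p ≡ q
    into-injective {inj₁ _} {inj₁ _} refl = refl
    into-injective {inj₂ _} {inj₂ _} refl = refl

  Small-Vec : {X : Set} → Small X → ∀ n → Small (Vec X n)
  Small-Vec s zero    = Small-↣ (mk↣ {to = λ _ → tt} λ { {[]} {[]} _ → refl }) Small-⊤
  Small-Vec s (suc n) = Small-↣ (mk↣ {to = λ { (x ∷ xs) → x , xs }} λ { {_ ∷ _} {_ ∷ _} refl → refl })
                                (Small-× s (Small-Vec s n))

  Small-List : {X : Set} → Small X → Small (List X)
  Small-List s = Small-↣ List↣ΣVec (Small-Σℕ (Small-Vec s))

  -- Prefixes of points of 2^ω; sets without a countably infinite subset.

  -- Distinct points differ at some coordinate, and only finitely many pairs are concerned.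
  separating : (fs : List (𝒫 ℕ)) →
    Ev (λ n → All (λ f → All (λ g → (∀ i → i < n → f i ≡ g i) → f ≡ g) fs) fs)
  separating fs = Ev-All fs λ f → Ev-All fs λ g → separate f g
    where
    separate : ∀ f g → Ev (λ n → (∀ i → i < n → f i ≡ g i) → f ≡ g)
    separate f g with em {∃ λ i → ¬ f i ≡ g i}
    ... | yes (i , fi≢gi) = suc i , λ n i<n agree → ⊥-elim (fi≢gi (agree i i<n))
    ... | no  none        = 0 , λ _ _ _ → ext λ i → by-contradiction λ fi≢gi → none (i , fi≢gi)

  prefix : 𝒫 ℕ → ℕ → List ℕ
  prefix f zero    = []
  prefix f (suc n) = (if f n then 1 else 0) ∷ prefix f n

  prefix-agree : ∀ f g n → prefix f n ≡ prefix g n → ∀ i → i < n → f i ≡ g i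
  prefix-agree f g (suc n) eq i (s≤s i≤n) with ℕ.m≤n⇒m<n∨m≡n i≤n
  ... | inj₁ i<n  = prefix-agree f g n (cong tail eq) i i<n
    where
    tail : List ℕ → List ℕ
    tail []       = []
    tail (_ ∷ xs) = xs
  ... | inj₂ refl = bit (f n) (g n) (cong head eq)
    where
    head : List ℕ → ℕ
    head []      = 0
    head (x ∷ _) = x
    bit : ∀ a b → (if a then 1 else 0) ≡ (if b then 1 else 0) → a ≡ b
    bit true  true  _ = refl
    bit false false _ = refl

  -- If no list exhausted `J`, repeatedly choosing an element outside the list so far would inject ℕ
  -- into `J`.
  ¬ℕ↣⇒enumerated : {J : Set} → ¬ (ℕ ↣ J) → ∃ λ js → ∀ (j : J) → j List.∈ js
  ¬ℕ↣⇒enumerated {J} ¬ℕ↣J = by-contradiction λ none → ¬ℕ↣J (mk↣ (new-injective none))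
    where
    None = ¬ (∃ λ js → ∀ (j : J) → j List.∈ js)
    fresh : None → ∀ js → ∃ λ j → ¬ j List.∈ js
    fresh none js = by-contradiction λ ¬fresh → none (js , λ j → by-contradiction λ j∉ → ¬fresh (j , j∉))
    module _ (none : None) where
      before : ℕ → List J
      new : ℕ → J
      before zero    = []
      before (suc n) = new n ∷ before n
      new n = proj₁ (fresh none (before n))
      new∈before : ∀ {m n} → m < n → new m List.∈ before n
      new∈before {m} {suc n} (s≤s m≤n) with ℕ.m≤n⇒m<n∨m≡n m≤n
      ... | inj₁ m<n  = there (new∈before m<n)
      ... | inj₂ refl = here refl
      new-≢ : ∀ {m n} → m < n → ¬ new m ≡ new n
      new-≢ {m} {n} m<n eq = proj₂ (fresh none (before n)) (subst (List._∈ before n) eq (new∈before m<n))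
      new-injective : ∀ {m n} → new m ≡ new n → m ≡ n
      new-injective {m} {n} eq with ℕ.<-cmp m n
      ... | tri< m<n _ _ = ⊥-elim (new-≢ m<n eq)
      ... | tri≈ _ m≡n _ = m≡n
      ... | tri> _ _ n<m = ⊥-elim (new-≢ n<m (sym eq))

  -- Sets of size less than a regular cardinal.

  module Regular (κ : Cardinal) (ℕ↣κ : ℕ ↣ ∣ κ ∣) (regular : IsCofinality κ κ) where
    open Cardinal κ using () renaming (_<_ to _≺κ_; isStrictTotalOrder to isSTO)
    open IsStrictTotalOrder isSTO using (compare) renaming (irrefl to ≺κ-irrefl; trans to ≺κ-trans)

    -- Size less than κ in negative form; `Few⇒↣seg` recovers an embedding into an initial segment.
    Few : Set → Set
    Few X = ¬ (∣ κ ∣ ↣ X)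

    Few-↣ : {X Y : Set} → X ↣ Y → Few Y → Few X
    Few-↣ f few g = few (f ↣-∘ g)

    -- Otherwise the range of `f` is cofinal, so by regularity κ injects into it and hence into `X`.
    Few-bounded : {X : Set} → Few X → (f : X → ∣ κ ∣) → ∃ λ δ → ∀ x → f x ≺κ δ
    Few-bounded few f = by-contradiction λ unbounded →
      few (range-↣ f ↣-∘ proj₂ regular ⟦ InRange ⟧ (cofinal unbounded))
      where
      InRange = λ y → ∃ λ x → f x ≡ y
      cofinal : ¬ (∃ λ δ → ∀ x → f x ≺κ δ) → Cofinal κ ⟦ InRange ⟧
      cofinal unbounded α = by-contradiction λ none → unbounded (α , λ x → below none x (compare (f x) α))
        where
        below : ¬ _ → ∀ x → Tri (f x ≺κ α) (f x ≡ α) (α ≺κ f x) → f x ≺κ α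
        below none x (tri< lt _ _) = lt
        below none x (tri≈ _ eq _) = ⊥-elim (none (f x , ∈⟦⟧⁺ InRange (x , refl) , inj₂ (sym eq)))
        below none x (tri> _ _ gt) = ⊥-elim (none (f x , ∈⟦⟧⁺ InRange (x , refl) , inj₁ gt))

    -- An injection φ of κ into the sum has its fibres over I bounded, say
    -- by g i, and the g i bounded by δ; but φ δ lies over some i, so δ < g i < δ.
    Few-Σ : {I : Set} {B : I → Set} → Few I → (∀ i → Few (B i)) → Few (Σ I B)
    Few-Σ {I} {B} fewI fewB φ = ≺κ-irrefl refl (≺κ-trans (δ<g (proj₁ (to φ δ)) (δ , refl)) (proj₂ all-bounded _))
      where
      Fibre : I → Set
      Fibre i = ∃ λ ξ → proj₁ (to φ ξ) ≡ i
      into-B : ∀ i → Fibre i → B i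
      into-B i (ξ , eq) = subst B eq (proj₂ (to φ ξ))
      into-B-injective : ∀ i {p q} → into-B i p ≡ into-B i q → p ≡ q
      into-B-injective i {ξ , eq} {ζ , eq′} same =
        Σ-irrelevant-≡ uip (injective φ (aux (to φ ξ) (to φ ζ) eq eq′ same))
        where
        aux : ∀ p q (eq : proj₁ p ≡ i) (eq′ : proj₁ q ≡ i) →
              subst B eq (proj₂ p) ≡ subst B eq′ (proj₂ q) → p ≡ q
        aux p q refl refl refl = refl
      bounded : ∀ i → ∃ λ γ → (p : Fibre i) → proj₁ p ≺κ γ
      bounded i = Few-bounded (Few-↣ (mk↣ (into-B-injective i)) (fewB i)) proj₁
      all-bounded : ∃ λ δ → ∀ i → proj₁ (bounded i) ≺κ δ
      all-bounded = Few-bounded fewI (proj₁ ∘ bounded)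
      δ = proj₁ all-bounded
      δ<g : ∀ i (p : Fibre i) → proj₁ p ≺κ proj₁ (bounded i)
      δ<g i = proj₂ (bounded i)

    -- An injection of κ would take three distinct values on the images of 0, 1 and 2.
    Few-Bool : Few Bool
    Few-Bool φ = distinct (three (g 0) (g 1) (g 2))
      where
      g = to (φ ↣-∘ ℕ↣κ)
      g-injective = injective (φ ↣-∘ ℕ↣κ)
      three : ∀ a b c → a ≡ b ⊎ a ≡ c ⊎ b ≡ c
      three false false _     = inj₁ refl
      three false true  false = inj₂ (inj₁ refl)
      three false true  true  = inj₂ (inj₂ refl)
      three true  true  _     = inj₁ refl
      three true  false true  = inj₂ (inj₁ refl)
      three true  false false = inj₂ (inj₂ refl)
      distinct : g 0 ≡ g 1 ⊎ g 0 ≡ g 2 ⊎ g 1 ≡ g 2 → ⊥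
      distinct (inj₁ eq)        with () ← g-injective eq
      distinct (inj₂ (inj₁ eq)) with () ← g-injective eq
      distinct (inj₂ (inj₂ eq)) with () ← g-injective eq

    Few-⊤ : Few ⊤
    Few-⊤ = Few-↣ (mk↣ {to = λ _ → true} λ _ → refl) Few-Bool

    Few-⊎ : {X Y : Set} → Few X → Few Y → Few (X ⊎ Y)
    Few-⊎ {X} {Y} fewX fewY = Few-↣ (mk↣ into-injective) (Few-Σ Few-Bool few)
      where
      B : Bool → Set
      B b = if b then X else Y
      few : ∀ b → Few (B b)
      few true  = fewX
      few false = fewY
      into : X ⊎ Y → Σ Bool B
      into (inj₁ x) = true , x
      into (inj₂ y) = false , y
      into-injective : ∀ {p q} → into p ≡ into q → p ≡ q
      into-injective {inj₁ _} {inj₁ _} refl = refl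
      into-injective {inj₂ _} {inj₂ _} refl = refl

    Few-Vec : {X : Set} → Few X → ∀ n → Few (Vec X n)
    Few-Vec few zero    = Few-↣ (mk↣ {to = λ _ → tt} λ { {[]} {[]} _ → refl }) Few-⊤
    Few-Vec few (suc n) = Few-↣ (mk↣ {to = λ { (x ∷ xs) → x , xs }} λ { {_ ∷ _} {_ ∷ _} refl → refl })
                                (Few-Σ few λ _ → Few-Vec few n)

    -- Lists are a sum over ω many lengths, so κ is taken uncountable here.
    Few-List : {X : Set} → Few X → Few ℕ → Few (List X)
    Few-List few fewℕ = Few-↣ List↣ΣVec (Few-Σ fewℕ (Few-Vec few))

    Few-⋃ : {I X : Set} → Few I → (N : I → 𝒫 X) → (∀ i → Few (Elements (N i))) →
            Few (Elements ⟦ (λ x → ∃ λ i → x ∈ N i) ⟧)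
    Few-⋃ {I} {X} fewI N few = Few-↣ (mk↣ {to = into} λ {p} {q} eq → Elements-≡ (cong (proj₁ ∘ proj₂) eq))
                                     (Few-Σ fewI few)
      where
      into : Elements ⟦ (λ x → ∃ λ i → x ∈ N i) ⟧ → Σ I (Elements ∘ N)
      into (x , x∈) = let i , x∈N = ∈⟦⟧⁻ (λ x → ∃ λ i → x ∈ N i) x∈ in i , x , x∈N

    -- Enumerate `W` along κ without repetition. If this never exhausted `W`, it would inject κ; so
    -- it stops at some ξ, and each element is sent to a place below ξ.
    Few⇒↣seg : {W : Set} → Few W → ∃ λ ξ → W ↣ seg κ ξ
    Few⇒↣seg {W} few with em {W}
    ... | no  ¬w = to ℕ↣κ 0 , mk↣ {to = λ w → ⊥-elim (¬w w)} λ {w} _ → ⊥-elim (¬w w)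
    -- `w₀` only fills the places where no new element is left.
    ... | yes w₀ = exhausted em
      where
      Fresh : ∀ {ξ} → (seg κ ξ → W) → Set
      Fresh prev = ∃ λ w → ∀ p → ¬ prev p ≡ w
      pick : ∀ {ξ} {prev : seg κ ξ → W} → Dec (Fresh prev) → W
      pick (yes (w , _)) = w
      pick (no _)        = w₀
      pick-fresh : ∀ {ξ} {prev : seg κ ξ → W} (d : Dec (Fresh prev)) → Fresh prev → ∀ p → ¬ prev p ≡ pick d
      pick-fresh (yes (_ , fresh)) _     = fresh
      pick-fresh (no none)         fresh = ⊥-elim (none fresh)
      rec = recursion κ {W} (λ ξ prev → pick (em {Fresh prev}))
      f = proj₁ rec
      exhausted : Dec (∃ λ ξ → ∀ w → ∃ λ (p : seg κ ξ) → f (proj₁ p) ≡ w) → _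
      exhausted (yes (ξ , onto)) = ξ , mk↣ {to = proj₁ ∘ onto} λ {v} {w} eq →
        trans (sym (proj₂ (onto v))) (trans (cong (f ∘ proj₁) eq) (proj₂ (onto w)))
      exhausted (no none) = ⊥-elim (few (mk↣ {to = f} f-injective))
        where
        fresh : ∀ ξ → Fresh {ξ} (f ∘ proj₁)
        fresh ξ = by-contradiction λ ¬fresh → none (ξ , λ w → by-contradiction λ unhit →
          ¬fresh (w , λ p eq → unhit (p , eq)))
        f-new : ∀ ξ (p : seg κ ξ) → ¬ f (proj₁ p) ≡ f ξ
        f-new ξ p eq = pick-fresh em (fresh ξ) p (trans eq (proj₂ rec ξ))
        f-injective : ∀ {ξ ζ} → f ξ ≡ f ζ → ξ ≡ ζ
        f-injective {ξ} {ζ} eq with compare ξ ζ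
        ... | tri< lt _ _ = ⊥-elim (f-new ζ (ξ , lt) eq)
        ... | tri≈ _ ξ≡ζ _ = ξ≡ζ
        ... | tri> _ _ gt = ⊥-elim (f-new ξ (ζ , gt) (sym eq))

  -- Consequences of 𝔭 = 𝔠.

  module Continuum (𝔠 : Cardinal) (𝔠⤖𝒫ℕ : ∣ 𝔠 ∣ ⤖ 𝒫 ℕ) (is𝔭 : Is𝔭 𝔠) where

    𝔠↣𝒫ℕ : ∣ 𝔠 ∣ ↣ 𝒫 ℕ
    𝔠↣𝒫ℕ = Bijection.injection 𝔠⤖𝒫ℕ

    𝒫ℕ↣𝔠 : 𝒫 ℕ ↣ ∣ 𝔠 ∣
    𝒫ℕ↣𝔠 = ↔⇒↣ (↔-sym (⤖⇒↔ 𝔠⤖𝒫ℕ))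

    -- Otherwise 2^𝔠 embeds in 2^X, then in 2^ω and in 𝔠, against Cantor.
    Small⇒¬↣ : {X : Set} → Small X → ¬ (∣ 𝔠 ∣ ↣ X)
    Small⇒¬↣ s f = cantor (𝒫ℕ↣𝔠 ↣-∘ (s ↣-∘ 𝒫-mono f))

    -- Without a pseudointersection, minimality of 𝔭 would inject 𝔠 into the range of `K` and hence
    -- into `X`.
    pseudointersection : {X : Set} → ¬ (∣ 𝔠 ∣ ↣ X) → (K : X → 𝒫 ℕ) →
      (∀ τ → Inf (λ n → All (λ x → n ∈ K x) τ)) →
      ∃ λ z → Inf (_∈ z) × (∀ x → Ev (λ m → m ∈ z → m ∈ K x))
    pseudointersection {X} ¬𝔠↣X K sfip = found em
      where
      InRange : 𝒫 ℕ → Set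
      InRange a = ∃ λ x → K x ≡ a
      𝒜 : 𝒫 (𝒫 ℕ)
      𝒜 = ⟦ InRange ⟧
      lift : ∀ σ → All (_∈ 𝒜) σ → ∃ λ τ → map K τ ≡ σ
      lift []      []        = [] , refl
      lift (a ∷ σ) (a∈ ∷ σ∈) with ∈⟦⟧⁻ InRange a∈ | lift σ σ∈
      ... | x , refl | τ , refl = x ∷ τ , refl
      𝒜-sfip : SFIP 𝒜
      𝒜-sfip σ σ∈ with lift σ σ∈
      ... | τ , refl = Inf⇒Infinite (Inf-map (λ n all → AllP.all⁻ (λ A → A n) (AllP.map⁺ all)) (sfip τ))
      infinite : ∀ a → a ∈ 𝒜 → Infinite a
      infinite a a∈ with ∈⟦⟧⁻ InRange a∈
      ... | x , refl = Inf⇒Infinite (Inf-map (λ { n (n∈ ∷ []) → n∈ }) (sfip (x ∷ [])))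
      found : Dec (∃ (NontrivialPseudointersection 𝒜)) → _
      found (yes (z , inf , almost)) = z , Infinite⇒Inf inf , λ x →
        ⊇*⇒Ev (K x) z (almost (K x) (∈⟦⟧⁺ InRange (x , refl)))
      found (no none) = ⊥-elim (¬𝔠↣X (range-↣ K ↣-∘ proj₂ is𝔭 𝒜 (infinite , 𝒜-sfip , none)))

    -- A generic sequence of conditions from a countable set `H`: the codes of conditions satisfying
    -- `K x` form a family with the SFIP, and `S k` decodes an element of a pseudointersection that
    -- is at least `k`.
    eventually-met : {X H : Set} → ¬ (∣ 𝔠 ∣ ↣ X) → H ↣ ℕ → (K : X → H → Set) →
      (∀ τ → ∃ λ h → All (λ x → K x h) τ) →
      ∃ λ (S : ℕ → H) → ∀ x → Ev (λ k → K x (S k))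
    eventually-met {X} {H} ¬𝔠↣X ι K met = S , S-meets
      where
      -- The tag makes every K x infinite.
      code : ℕ × H → ℕ
      code (t , h) = pair t (to ι h)
      decode : ℕ → H
      decode k with em {∃ λ p → code p ≡ k}
      ... | yes ((_ , h) , _) = h
      -- Numbers that code nothing are read as a default condition, which exists because the empty
      -- list is met.
      ... | no  _             = proj₁ (met [])
      decode-code : ∀ t h → decode (code (t , h)) ≡ h
      decode-code t h with em {∃ λ p → code p ≡ code (t , h)}
      ... | yes ((t′ , h′) , eq) = injective ι (proj₂ (pair-injective t′ t eq))
      ... | no  none             = ⊥-elim (none ((t , h) , refl))
      K̂ : X → ℕ → Set
      K̂ x k = K x (decode k)
      sfip : ∀ τ → Inf (λ k → All (λ x → k ∈ ⟦ K̂ x ⟧) τ)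
      sfip τ n with met τ
      ... | h , all = code (n , h) , ℕ.<⇒≤ (m<pair n (to ι h)) ,
        All.map (λ {x} p → ∈⟦⟧⁺ (K̂ x) (subst (K x) (sym (decode-code n h)) p)) all
      z : ∃ λ z → Inf (_∈ z) × (∀ x → Ev (λ m → m ∈ z → m ∈ ⟦ K̂ x ⟧))
      z = pseudointersection ¬𝔠↣X (λ x → ⟦ K̂ x ⟧) sfip
      S : ℕ → H
      S k = decode (proj₁ (proj₁ (proj₂ z) k))
      S-meets : ∀ x → Ev (λ k → K x (S k))
      S-meets x with proj₂ (proj₂ z) x
      ... | n , ev = n , λ k n≤k →
        let k′ , k≤k′ , k′∈z = proj₁ (proj₂ z) k in ∈⟦⟧⁻ (K̂ x) (ev k′ (ℕ.≤-trans n≤k k≤k′) k′∈z)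

    -- The sets {(n , s) ∣ f↾n ∈ s}, f ∈ 2^ω, are independent, so each
    -- Y ⊆ X yields a sequence that eventually meets the conditions
    -- Y prescribes; distinct Y contradict each other.
    small : {X : Set} → X ↣ 𝒫 ℕ → ¬ (∣ 𝔠 ∣ ↣ X) → Small X
    small {X} ι ¬𝔠↣X = sequences↣ ↣-∘ mk↣ (λ {Y} {Y′} → separated Y Y′)
      where
      Code : X → ℕ → ℕ
      Code x n = encode (prefix (to ι x) n)
      Chosen : X → ℕ × List ℕ → Set
      Chosen x (n , s) = Code x n List.∈ s
      K : 𝒫 X → X → ℕ × List ℕ → Set
      K Y x h = (x ∈ Y → Chosen x h) × (¬ x ∈ Y → ¬ Chosen x h)
      met : ∀ Y τ → ∃ λ h → All (λ x → K Y x h) τ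
      met Y τ with separating (map (to ι) τ)
      ... | n , sep = (n , s) , tabulate λ {x} x∈τ → pos x∈τ , neg x∈τ
        where
        s : List ℕ
        s = map (λ x → Code x n) (filter (λ x → T? (Y x)) τ)
        pos : ∀ {x} → x List.∈ τ → x ∈ Y → Chosen x (n , s)
        pos x∈τ x∈Y = ∈-map⁺ _ (∈-filter⁺ (λ x → T? (Y x)) x∈τ x∈Y)
        neg : ∀ {x} → x List.∈ τ → ¬ x ∈ Y → ¬ Chosen x (n , s)
        -- A code shared with some `x′` in `Y` means equal prefixes, hence `x` = `x′` by the choice
        -- of `n`.
        neg {x} x∈τ x∉Y chosen with ∈-map⁻ _ chosen
        ... | x′ , x′∈ , eq with ∈-filter⁻ (λ x → T? (Y x)) x′∈
        ... | x′∈τ , x′∈Y = x∉Y (subst (_∈ Y) (sym (injective ι (lookup (lookup (sep n ℕ.≤-refl)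
                (∈-map⁺ (to ι) x∈τ)) (∈-map⁺ (to ι) x′∈τ)
                (prefix-agree _ _ n (encode-injective eq))))) x′∈Y)
      H↣ℕ : (ℕ × List ℕ) ↣ ℕ
      H↣ℕ = ℕ×ℕ↣ℕ ↣-∘ ×-mono-↣ (mk↣ id) Listℕ↣ℕ
      S : ∀ Y → ∃ λ (S : ℕ → ℕ × List ℕ) → ∀ x → Ev (λ n → K Y x (S n))
      S Y = eventually-met ¬𝔠↣X H↣ℕ (K Y) (met Y)
      -- Each condition becomes the singleton of its code, so that `sequences↣` applies.
      graph : 𝒫 X → ℕ → ℕ → Set
      graph Y n m = m ≡ to H↣ℕ (proj₁ (S Y) n)
      S≡ : ∀ Y Y′ → (λ n → ⟦ graph Y n ⟧) ≡ (λ n → ⟦ graph Y′ n ⟧) → ∀ n → proj₁ (S Y) n ≡ proj₁ (S Y′) n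
      S≡ Y Y′ eq n = injective H↣ℕ {proj₁ (S Y) n} {proj₁ (S Y′) n} (∈⟦⟧⁻ (graph Y′ n)
        (subst (to H↣ℕ (proj₁ (S Y) n) ∈_) (cong-app eq n) (∈⟦⟧⁺ (graph Y n) refl)))
      half : ∀ Y Y′ → (∀ n → proj₁ (S Y) n ≡ proj₁ (S Y′) n) → Y ⊆ Y′
      half Y Y′ same x x∈Y = by-contradiction λ x∉Y′ →
        let n , ev = Ev-× (proj₂ (S Y) x) (proj₂ (S Y′) x)
            k , k′ = ev n ℕ.≤-refl
        in proj₂ k′ x∉Y′ (subst (Chosen x) (same n) (proj₁ k x∈Y))
      separated : ∀ Y Y′ → (λ n → ⟦ graph Y n ⟧) ≡ (λ n → ⟦ graph Y′ n ⟧) → Y ≡ Y′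
      separated Y Y′ eq = 𝒫-≡ (half Y Y′ (S≡ Y Y′ eq)) (half Y′ Y (λ n → sym (S≡ Y Y′ eq n)))

    -- Pseudointersections meeting prescribed sets, and splitting sets.

    -- Necessary for a pseudointersection of the `h j` to meet `b i` in an infinite set.
    Compatible : {J I : Set} (h : J → 𝒫 ℕ) (b : I → ℕ → Set) → I → Set
    Compatible h b i = ∀ js → Inf (λ m → All (λ j → m ∈ h j) js × b i m)

    record Blocks {J I : Set} (h : J → 𝒫 ℕ) (b : I → ℕ → Set) : Set where
      field
        block   : ℕ → List ℕ
        inside  : ∀ j → Ev (λ k → All (_∈ h j) (block k))
        beyond  : ∀ n → Ev (λ k → All (n ≤_) (block k))
        meeting : ∀ i → Compatible h b i → Ev (λ k → Any (b i) (block k))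

    -- The conditions are finite sets. Finitely many requirements are met by taking, for each
    -- compatible `b i` among them, one point of `b i` in the required `h j` and above the required
    -- bounds.
    blocks : {J I : Set} → Small J → Small I → (h : J → 𝒫 ℕ) (b : I → ℕ → Set) → Blocks h b
    blocks {J} {I} smallJ smallI h b = from
      (eventually-met (Small⇒¬↣ (Small-⊎ smallJ (Small-⊎ Small-ℕ smallI))) Listℕ↣ℕ K met)
      where
      Guard = Compatible h b
      X : Set
      X = J ⊎ ℕ ⊎ I
      Allowed : X → ℕ → Set
      Allowed (inj₁ j)        m = m ∈ h j
      Allowed (inj₂ (inj₁ n)) m = n ≤ m
      Allowed (inj₂ (inj₂ _)) m = ⊤
      Hits : X → List ℕ → Set
      Hits (inj₂ (inj₂ i)) s = Guard i → Any (b i) s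
      Hits _               s = ⊤
      Hits-∷ : ∀ x {m s} → Hits x s → Hits x (m ∷ s)
      Hits-∷ (inj₁ _)        _    = tt
      Hits-∷ (inj₂ (inj₁ _)) _    = tt
      Hits-∷ (inj₂ (inj₂ _)) hits = there ∘ hits
      K : X → List ℕ → Set
      K x s = All (Allowed x) s × Hits x s
      -- Condenses the requirements in `τ` to one finite intersection and one lower bound.
      room : ∀ τ → ∃ λ js → ∃ λ n → ∀ m → n ≤ m → All (λ j → m ∈ h j) js → All (λ x → Allowed x m) τ
      room []                    = [] , 0 , λ _ _ _ → []
      room (inj₁ j ∷ τ)          with room τ
      ... | js , n , ok = j ∷ js , n , λ { m n≤m (m∈ ∷ all) → m∈ ∷ ok m n≤m all }
      room (inj₂ (inj₁ n′) ∷ τ)  with room τ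
      ... | js , n , ok = js , n′ + n , λ m le all →
        ℕ.≤-trans (ℕ.m≤m+n n′ n) le ∷ ok m (ℕ.≤-trans (ℕ.m≤n+m n n′) le) all
      room (inj₂ (inj₂ i) ∷ τ)   with room τ
      ... | js , n , ok = js , n , λ m n≤m all → tt ∷ ok m n≤m all
      -- `τ` stays fixed while `σ` is consumed, since every point added must respect all of `τ`.
      build : ∀ τ σ → ∃ λ s → All (λ m → All (λ x → Allowed x m) τ) s × All (λ x → Hits x s) σ
      build τ []                    = [] , [] , []
      build τ (inj₁ _ ∷ σ)          with build τ σ
      ... | s , allowed , hits = s , allowed , tt ∷ hits
      build τ (inj₂ (inj₁ _) ∷ σ)   with build τ σ
      ... | s , allowed , hits = s , allowed , tt ∷ hits
      build τ (inj₂ (inj₂ i) ∷ σ)   with build τ σ | em {Guard i}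
      ... | s , allowed , hits | no ¬guard = s , allowed , (λ guard → ⊥-elim (¬guard guard)) ∷ hits
      ... | s , allowed , hits | yes guard with room τ
      ... | js , n , ok with guard js n
      ... | m , n≤m , all , bm = m ∷ s , ok m n≤m all ∷ allowed , (λ _ → here bm) ∷ All.map (λ {x} → Hits-∷ x) hits
      met : ∀ τ → ∃ λ s → All (λ x → K x s) τ
      met τ with build τ τ
      ... | s , allowed , hits = s , tabulate λ x∈τ → All.map (λ all → lookup all x∈τ) allowed , lookup hits x∈τ
      from : (∃ λ (S : ℕ → List ℕ) → ∀ x → Ev (λ k → K x (S k))) → Blocks h b
      from (S , meets) = record
        { block   = S
        ; inside  = λ j → Ev-map (λ _ → proj₁) (meets (inj₁ j))
        ; beyond  = λ n → Ev-map (λ _ → proj₁) (meets (inj₂ (inj₁ n)))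
        ; meeting = λ i guard → Ev-map (λ _ k → proj₂ k guard) (meets (inj₂ (inj₂ i)))
        }

    Meeting : {J I : Set} (h : J → 𝒫 ℕ) (b : I → ℕ → Set) → 𝒫 ℕ → Set
    Meeting h b y = (∀ j → Ev (λ m → m ∈ y → m ∈ h j)) × (∀ i → Compatible h b i → Inf (λ m → b i m × m ∈ y))

    -- Take the union of the blocks: all but finitely many lie inside `h j`, and since they move
    -- beyond every `n`, their hits on `b i` are unbounded.
    pseudointersection-meeting : {J I : Set} {h : J → 𝒫 ℕ} {b : I → ℕ → Set} → Blocks h b → ∃ (Meeting h b)
    pseudointersection-meeting {h = h} {b} B = ⟦ Y ⟧ , almost , meet
      where
      open Blocks B
      Y : ℕ → Set
      Y m = ∃ λ k → m List.∈ block k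
      almost : ∀ j → Ev (λ m → m ∈ ⟦ Y ⟧ → m ∈ h j)
      almost j with inside j
      ... | n , ev = Ev-map aux (Ev-All (upTo n) (λ k → Ev-∉ (block k)))
        where
        aux : ∀ m → All (λ k → ¬ m List.∈ block k) (upTo n) → m ∈ ⟦ Y ⟧ → m ∈ h j
        aux m early m∈ with ∈⟦⟧⁻ Y m∈
        ... | k , m∈Sk with ℕ.<-≤-connex k n
        ... | inj₁ k<n = ⊥-elim (lookup early (∈-upTo⁺ k<n) m∈Sk)
        ... | inj₂ n≤k = lookup (ev k n≤k) m∈Sk
      meet : ∀ i → Compatible h b i → Inf (λ m → b i m × m ∈ ⟦ Y ⟧)
      meet i guard n with Ev-× (meeting i guard) (beyond n)
      ... | k , ev with ev k ℕ.≤-refl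
      ... | hit , all with List.find hit
      ... | m , m∈ , bm = m , lookup all m∈ , bm , ∈⟦⟧⁺ Y (k , m∈)

    Splits : {I : Set} (b : I → ℕ → Set) → 𝒫 ℕ → Set
    Splits b x = ∀ i → Inf (b i) → Inf (λ m → b i m × m ∈ x) × Inf (λ m → b i m × ¬ m ∈ x)

    -- Every infinite `b i` meets [n, next n) for all large `n`, so a union of alternate intervals
    -- splits it.
    splitting : {I : Set} {b : I → ℕ → Set} → Blocks {⊥} (λ ()) b → ∃ (Splits b)
    splitting {I} {b} B = ⟦ Even ⟧ , λ i inf → in-even i inf , in-odd i inf
      where
      open Blocks B renaming (block to S)
      -- The index puts the block beyond `n`, and is at least `n` so that every infinite `b i` is
      -- eventually hit.
      block : ℕ → List ℕ
      block n = S (proj₁ (beyond n) ⊔ n)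
      next : ℕ → ℕ
      next n = suc (n + sum (block n))
      n<next : ∀ n → n < next n
      n<next n = s≤s (ℕ.m≤m+n n _)
      guard : ∀ i → Inf (b i) → Compatible (λ ()) b i
      guard i inf []       = Inf-map (λ _ bm → [] , bm) inf
      guard i inf (() ∷ _)
      hit : ∀ i → Inf (b i) → Ev (λ n → ∃ λ m → b i m × n ≤ m × m < next n)
      hit i inf with meeting i (guard i inf)
      ... | n₀ , ev = n₀ , aux
        where
        aux : ∀ n → n₀ ≤ n → ∃ λ m → b i m × n ≤ m × m < next n
        aux n n₀≤n with List.find (ev (proj₁ (beyond n) ⊔ n) (ℕ.≤-trans n₀≤n (ℕ.m≤n⊔m _ n)))
        ... | m , m∈ , bm = m , bm , lookup (proj₂ (beyond n) _ (ℕ.m≤m⊔n _ n)) m∈ ,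
                            s≤s (ℕ.≤-trans (∈⇒≤sum m∈) (ℕ.m≤n+m _ n))
      -- [start j, next (start j)) goes into the set; [next (start j), start (suc j)) stays out.
      start : ℕ → ℕ
      start zero    = 0
      start (suc j) = next (next (start j))
      start<mid : ∀ j → next (start j) < start (suc j)
      start<mid j = n<next (next (start j))
      start-mono : ∀ {j k} → j ≤ k → start j ≤ start k
      start-mono {j} {zero}  z≤n = z≤n
      start-mono {j} {suc k} le with ℕ.m≤n⇒m<n∨m≡n le
      ... | inj₂ refl      = ℕ.≤-refl
      ... | inj₁ (s≤s j≤k) = ℕ.≤-trans (start-mono j≤k) (ℕ.<⇒≤ (ℕ.<-trans (n<next _) (start<mid k)))
      j≤start : ∀ j → j ≤ start j
      j≤start zero    = z≤n
      j≤start (suc j) = ℕ.≤-trans (s≤s (j≤start j)) (ℕ.≤-trans (n<next _) (ℕ.<⇒≤ (start<mid j)))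
      Even : ℕ → Set
      Even m = ∃ λ j → start j ≤ m × m < next (start j)
      odd-∉ : ∀ {j m} → next (start j) ≤ m → m < start (suc j) → ¬ m ∈ ⟦ Even ⟧
      odd-∉ {j} {m} lo hi m∈ with ∈⟦⟧⁻ Even m∈
      ... | k , lo′ , hi′ with ℕ.<-cmp j k
      ... | tri< j<k _ _  = ℕ.<-irrefl refl (ℕ.<-≤-trans hi (ℕ.≤-trans (start-mono j<k) lo′))
      ... | tri≈ _ refl _ = ℕ.<-irrefl refl (ℕ.<-≤-trans hi′ lo)
      ... | tri> _ _ k<j  = ℕ.<-irrefl refl (ℕ.<-≤-trans hi′ (ℕ.≤-trans (ℕ.<⇒≤ (start<mid k))
              (ℕ.≤-trans (start-mono k<j) (ℕ.≤-trans (ℕ.<⇒≤ (n<next _)) lo))))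
      in-even : ∀ i → Inf (b i) → Inf (λ m → b i m × m ∈ ⟦ Even ⟧)
      in-even i inf n with hit i inf
      ... | n₀ , ev with ev (start (n₀ + n)) (ℕ.≤-trans (ℕ.m≤m+n n₀ n) (j≤start _))
      ... | m , bm , lo , hi = m , ℕ.≤-trans (ℕ.≤-trans (ℕ.m≤n+m n n₀) (j≤start _)) lo ,
                               bm , ∈⟦⟧⁺ Even (n₀ + n , lo , hi)
      in-odd : ∀ i → Inf (b i) → Inf (λ m → b i m × ¬ m ∈ ⟦ Even ⟧)
      in-odd i inf n with hit i inf
      ... | n₀ , ev with ev (next (start (n₀ + n)))
                           (ℕ.≤-trans (ℕ.m≤m+n n₀ n) (ℕ.≤-trans (j≤start _) (ℕ.<⇒≤ (n<next _))))
      ... | m , bm , lo , hi = m , ℕ.≤-trans (ℕ.≤-trans (ℕ.m≤n+m n n₀) (j≤start _)) (ℕ.≤-trans (ℕ.<⇒≤ (n<next _)) lo) ,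
                               bm , odd-∉ {n₀ + n} lo hi

    -- Positivity and its preservation.

    module Construction (κ : Cardinal) (ℕ↣κ : ℕ ↣ ∣ κ ∣) (regular : IsCofinality κ κ)
                        (κ↣𝔠 : ∣ κ ∣ ↣ ∣ 𝔠 ∣) where
      open Regular κ ℕ↣κ regular

      R : {I X : Set} (e : I → 𝒫 ℕ) (x : X → 𝒫 ℕ) → List I → List X → ℕ → Set
      R e x u τ m = All (λ i → m ∈ e i) u × All (λ β → ¬ m ∈ x β) τ

      Avoids : {X : Set} → 𝒫 X → List X → Set
      Avoids N τ = All (λ β → ¬ β ∈ N) τ

      -- No finite intersection of the e i is almost covered by finitely many
      -- x β, once fewer than κ indices β are excluded.
      Positive : {I X : Set} (e : I → 𝒫 ℕ) (x : X → 𝒫 ℕ) → Set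
      Positive e x = ∀ u → ∃ λ N → Few (Elements N) × (∀ τ → Avoids N τ → Inf (R e x u τ))

      -- Amounts to positivity of `e` with `y` added as a further generator.
      Meets : {I X : Set} (e : I → 𝒫 ℕ) (x : X → 𝒫 ℕ) → 𝒫 ℕ → Set
      Meets e x y = ∀ u → ∃ λ N → Few (Elements N) ×
                    (∀ τ → Avoids N τ → Inf (λ m → R e x u τ m × m ∈ y))

      -- If ℕ itself is not few, then κ is countable, J is finite, and a list
      -- of all of J replaces the union over List J.
      uniform : {I J X : Set} {e : I → 𝒫 ℕ} {h : J → 𝒫 ℕ} {x : X → 𝒫 ℕ} →
        Few J → Positive [ e , h ]′ x → ∀ u → ∃ λ N → Few (Elements N) ×
        (∀ js τ → Avoids N τ → Inf (λ m → All (λ j → m ∈ h j) js × R e x u τ m))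
      uniform {I} {J} {X} {e} {h} {x} fewJ pos u = cases em
        where
        N : List J → 𝒫 X
        N js = proj₁ (pos (map inj₁ u ++ map inj₂ js))
        N-few : ∀ js → Few (Elements (N js))
        N-few js = proj₁ (proj₂ (pos (map inj₁ u ++ map inj₂ js)))
        N-inf : ∀ js τ → Avoids (N js) τ → Inf (λ m → All (λ j → m ∈ h j) js × R e x u τ m)
        N-inf js τ avoids = Inf-map
          (λ m (all , out) → AllP.map⁻ (AllP.++⁻ʳ (map inj₁ u) all) , AllP.map⁻ (AllP.++⁻ˡ (map inj₁ u) all) , out)
          (proj₂ (proj₂ (pos (map inj₁ u ++ map inj₂ js))) τ avoids)
        InSome : X → Set
        InSome β = ∃ λ js → β ∈ N js
        cases : Dec (Few ℕ) → _
        cases (yes fewℕ) = ⟦ InSome ⟧ , Few-⋃ (Few-List fewJ fewℕ) N N-few , λ js τ avoids →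
          N-inf js τ (All.map (λ β∉ β∈N → β∉ (∈⟦⟧⁺ InSome (js , β∈N))) avoids)
        cases (no ¬fewℕ) with ¬ℕ↣⇒enumerated (λ ℕ↣J → fewJ (ℕ↣J ↣-∘ by-contradiction ¬fewℕ))
        ... | js₀ , complete = N js₀ , N-few js₀ , λ js τ avoids →
          Inf-map (λ m (all , r) → tabulate (λ {j} _ → lookup all (complete j)) , r) (N-inf js₀ τ avoids)

      -- `uniform` makes `R e x u τ` compatible with the `h j` whenever `τ` avoids `N`, so a
      -- pseudointersection can be chosen to meet all these sets.
      extend : {I J X : Set} {e : I → 𝒫 ℕ} {h : J → 𝒫 ℕ} {x : X → 𝒫 ℕ} →
        Small I → Small J → Small X → Few J → Positive [ e , h ]′ x →
        ∃ λ y → (∀ j → Ev (λ m → m ∈ y → m ∈ h j)) × Meets e x y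
      extend {I} {J} {X} {e} {h} {x} smallI smallJ smallX fewJ pos = from
        (pseudointersection-meeting (blocks smallJ (Small-× (Small-List smallI) (Small-List smallX)) h b))
        where
        b : List I × List X → ℕ → Set
        b (u , τ) = R e x u τ
        from : ∃ (Meeting h b) → _
        from (y , below , meets) = y , below , λ u →
          let N , few , inf = uniform {e = e} {h} fewJ pos u
          in N , few , λ τ avoids → meets (u , τ) (λ js → inf js τ avoids)

      -- If the two halves failed at `u` and `u′`, the `N` given for `u ++ u′` would still serve one
      -- of them, since an infinite set has an infinite half.
      decide : {I X : Set} {e : I → 𝒫 ℕ} {x : X → 𝒫 ℕ} {y : 𝒫 ℕ} →
        Meets e x y → ∀ A → Meets e x (y ∩ A) ⊎ Meets e x (y ∩ ∁ A)
      decide {e = e} {x} {y} meets A with em {Meets e x (y ∩ A)}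
      ... | yes meetsA = inj₁ meetsA
      ... | no ¬meetsA = inj₂ λ u′ → by-contradiction λ none′ → ¬meetsA λ u → by-contradiction λ none →
          let N , few , inf = meets (u ++ u′) in
          none (N , few , λ τ avoids → by-contradiction λ ¬inf →
          none′ (N , few , λ τ′ avoids′ →
            Inf-⊎ (split u u′ τ τ′) ¬inf (inf (τ ++ τ′) (AllP.++⁺ avoids avoids′))))
        where
        split : ∀ u u′ τ τ′ m → R e x (u ++ u′) (τ ++ τ′) m × m ∈ y →
                (R e x u τ m × m ∈ y ∩ A) ⊎ (R e x u′ τ′ m × m ∈ y ∩ ∁ A)
        split u u′ τ τ′ m ((all , out) , m∈y) with T? (A m)
        ... | yes m∈A = inj₁ ((AllP.++⁻ˡ u all , AllP.++⁻ˡ τ out) , ∈-∩⁺ y A m∈y m∈A)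
        ... | no  m∉A = inj₂ ((AllP.++⁻ʳ u all , AllP.++⁻ʳ τ out) , ∈-∩⁺ y (∁ A) m∈y (∈-∁⁺ A m∉A))

      -- By regularity, every family of fewer than κ sets is indexed by an
      -- initial segment of κ.
      Task : Set
      Task = Σ ∣ κ ∣ λ η → seg κ η → 𝒫 ℕ

      abstract
        Small-segκ : ∀ η → Small (seg κ η)
        Small-segκ η = small (𝔠↣𝒫ℕ ↣-∘ (κ↣𝔠 ↣-∘ seg↣ κ η)) λ f → Cardinal.initial κ η (f ↣-∘ κ↣𝔠)

        Small-seg𝔠 : ∀ α → Small (seg 𝔠 α)
        Small-seg𝔠 α = small (𝔠↣𝒫ℕ ↣-∘ seg↣ 𝔠 α) (Cardinal.initial 𝔠 α)

      -- Gives each task its own stage. For fixed η, (2^ω)^η = 2^(η×ω) embeds in 2^ω because η is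
      -- small.
      Task↣𝔠 : Task ↣ ∣ 𝔠 ∣
      Task↣𝔠 = 𝒫ℕ↣𝔠 ↣-∘ (𝒫ℕ×𝒫ℕ↣𝒫ℕ ↣-∘ mk↣ {to = pairs} λ {s} {t} → pairs-injective s t)
        where
        𝒫ℕ×𝒫ℕ↣𝒫ℕ : (𝒫 ℕ × 𝒫 ℕ) ↣ 𝒫 ℕ
        𝒫ℕ×𝒫ℕ↣𝒫ℕ = Small-⊎ Small-ℕ Small-ℕ ↣-∘ mk↣ {to = λ (A , B) → [ A , B ]′} λ {p} {q} eq →
          cong₂ _,_ (ext λ n → cong-app eq (inj₁ n)) (ext λ n → cong-app eq (inj₂ n))
        functions↣ : ∀ η → (seg κ η → 𝒫 ℕ) ↣ 𝒫 ℕ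
        functions↣ η = Small-× (Small-segκ η) Small-ℕ ↣-∘
          mk↣ {to = uncurry} λ eq → ext λ ζ → ext λ n → cong-app eq (ζ , n)
        pairs : Task → 𝒫 ℕ × 𝒫 ℕ
        pairs (η , h) = to 𝔠↣𝒫ℕ (to κ↣𝔠 η) , to (functions↣ η) h
        pairs-injective : ∀ s t → pairs s ≡ pairs t → s ≡ t
        pairs-injective (η , h) (η′ , h′) eq with injective κ↣𝔠 {η} {η′} (injective 𝔠↣𝒫ℕ {to κ↣𝔠 η} {to κ↣𝔠 η′} (cong proj₁ eq))
        ... | refl = cong (η ,_) (injective (functions↣ η) {h} {h′} (cong proj₂ eq))

      -- One stage of the recursion.

      -- `meets` and `splits` keep the family positive, `decides` yields an ultrafilter, `below`
      -- puts `xα` into it, and `task` supplies lower bounds.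
      record Good {X : Set} (e x : X → 𝒫 ℕ) (α : ∣ 𝔠 ∣) (new : 𝒫 ℕ × 𝒫 ℕ) : Set where
        eα = proj₁ new
        xα = proj₂ new
        field
          meets   : Meets e x eα
          splits  : ∀ u τ → Inf (R e x u τ) → Inf (λ m → R e x u τ m × ¬ m ∈ xα)
          below   : eα ⊆ xα
          decides : eα ⊆ to 𝔠↣𝒫ℕ α ⊎ eα ⊆ ∁ (to 𝔠↣𝒫ℕ α)
          task    : ∀ t → to Task↣𝔠 t ≡ α → Positive [ e , proj₂ t ]′ x →
                    ∀ j → Ev (λ m → m ∈ eα → m ∈ proj₂ t j)

      module _ {X : Set} {e x : X → 𝒫 ℕ} (smallX : Small X) (pos : Positive e x) (α : ∣ 𝔠 ∣) where

        Serves : 𝒫 ℕ → Set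
        Serves y = ∀ t → to Task↣𝔠 t ≡ α → Positive [ e , proj₂ t ]′ x →
                   ∀ j → Ev (λ m → m ∈ y → m ∈ proj₂ t j)

        serve : ∃ λ y → Meets e x y × Serves y
        serve with em {∃ λ t → to Task↣𝔠 t ≡ α × Positive [ e , proj₂ t ]′ x}
        -- No consistent task belongs to this stage, so ℕ itself serves.
        ... | no none = (λ _ → true) ,
          (λ u → let N , few , inf = pos u in N , few , λ τ avoids → Inf-map (λ _ r → r , tt) (inf τ avoids)) ,
          λ t eq pos → ⊥-elim (none (t , eq , pos))
        ... | yes (t , code≡α , post) = from (extend {e = e} {proj₂ t} smallX (Small-segκ (proj₁ t)) smallX
                                               (Cardinal.initial κ (proj₁ t)) post)
          where
          from : (∃ λ y → (∀ j → Ev (λ m → m ∈ y → m ∈ proj₂ t j)) × Meets e x y) → _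
          from (y , below , meets) = y , meets , λ t′ eq _ →
            subst (λ t → ∀ j → Ev (λ m → m ∈ y → m ∈ proj₂ t j)) (injective Task↣𝔠 (trans code≡α (sym eq))) below

        served-decided : ∃ λ y → Meets e x y × Serves y × (y ⊆ to 𝔠↣𝒫ℕ α ⊎ y ⊆ ∁ (to 𝔠↣𝒫ℕ α))
        served-decided = from serve
          where
          A = to 𝔠↣𝒫ℕ α
          shrink : ∀ {y} B → Serves y → Serves (y ∩ B)
          shrink {y} B serves t eq post j = Ev-map (λ m f m∈ → f (proj₁ (∈-∩⁻ y B m∈))) (serves t eq post j)
          from : (∃ λ y → Meets e x y × Serves y) → _
          from (y , meets , serves) with decide {e = e} {x} {y} meets A
          ... | inj₁ meetsA = y ∩ A , meetsA , shrink A serves , inj₁ (λ m m∈ → proj₂ (∈-∩⁻ y A m∈))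
          ... | inj₂ meets∁ = y ∩ ∁ A , meets∁ , shrink (∁ A) serves , inj₂ (λ m m∈ → proj₂ (∈-∩⁻ y (∁ A) m∈))

        -- One `z` splits the sets `R e x u τ` and their traces on `y`. The traces keep `y ∩ z`
        -- meeting; the sets themselves keep an infinite part outside `z`.
        good-exists : ∃ (Good e x α)
        good-exists = from served-decided
          where
          Index : Set
          Index = (List X × List X) ⊎ (List X × List X)
          b : 𝒫 ℕ → Index → ℕ → Set
          b y (inj₁ (u , τ)) m = R e x u τ m
          b y (inj₂ (u , τ)) m = R e x u τ m × m ∈ y
          Small-Index : Small Index
          Small-Index = Small-⊎ smallLists smallLists
            where
            smallLists = Small-× (Small-List smallX) (Small-List smallX)
          Small-⊥ : Small ⊥
          Small-⊥ = Small-↣ (mk↣ {to = λ ()} λ { {()} }) Small-ℕ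
          from : (∃ λ y → Meets e x y × Serves y × (y ⊆ to 𝔠↣𝒫ℕ α ⊎ y ⊆ ∁ (to 𝔠↣𝒫ℕ α))) → _
          from (y , meets , serves , decided) = from′ (splitting (blocks Small-⊥ Small-Index (λ ()) (b y)))
            where
            from′ : ∃ (Splits (b y)) → ∃ (Good e x α)
            from′ (z , splits) = (y ∩ z , z) , record
              { meets   = λ u → let N , few , inf = meets u in N , few , λ τ avoids →
                  Inf-map (λ m ((r , m∈y) , m∈z) → r , ∈-∩⁺ y z m∈y m∈z)
                          (proj₁ (splits (inj₂ (u , τ)) (inf τ avoids)))
              ; splits  = λ u τ inf → proj₂ (splits (inj₁ (u , τ)) inf)
              ; below   = λ m m∈ → proj₂ (∈-∩⁻ y z m∈)
              ; decides = narrow decided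
              ; task    = λ t eq post j → Ev-map (λ m f m∈ → f (proj₁ (∈-∩⁻ y z m∈))) (serves t eq post j)
              }
              where
              narrow : ∀ {A} → y ⊆ A ⊎ y ⊆ ∁ A → y ∩ z ⊆ A ⊎ y ∩ z ⊆ ∁ A
              narrow (inj₁ y⊆) = inj₁ λ m m∈ → y⊆ m (proj₁ (∈-∩⁻ y z m∈))
              narrow (inj₂ y⊆) = inj₂ λ m m∈ → y⊆ m (proj₁ (∈-∩⁻ y z m∈))

      -- The recursion along 𝔠.

      GoodAt : (∣ 𝔠 ∣ → 𝒫 ℕ × 𝒫 ℕ) → ∣ 𝔠 ∣ → Set
      GoodAt gen α = Good {seg 𝔠 α} (proj₁ ∘ gen ∘ proj₁) (proj₂ ∘ gen ∘ proj₁) α (gen α)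

      PositiveBelow : (∣ 𝔠 ∣ → 𝒫 ℕ × 𝒫 ℕ) → ∣ 𝔠 ∣ → Set
      PositiveBelow gen α = Positive {seg 𝔠 α} {seg 𝔠 α} (proj₁ ∘ gen ∘ proj₁) (proj₂ ∘ gen ∘ proj₁)

      -- Goodness is conditional because positivity is derived only afterwards; a stage without a
      -- good pair takes a dummy value.
      generators : ∃ λ gen → ∀ α → PositiveBelow gen α → GoodAt gen α
      generators = gen , λ α pos → subst (Good _ _ α) (sym (gen-eq α))
                                     (choose-good em (good-exists (Small-seg𝔠 α) pos α))
        where
        choose : {P : 𝒫 ℕ × 𝒫 ℕ → Set} → Dec (∃ P) → 𝒫 ℕ × 𝒫 ℕ
        choose (yes (p , _)) = p
        choose (no _)        = ∅ , ∅
        choose-good : {P : 𝒫 ℕ × 𝒫 ℕ → Set} (d : Dec (∃ P)) → ∃ P → P (choose d)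
        choose-good (yes (_ , p)) _ = p
        choose-good (no none)     p = ⊥-elim (none p)
        gen×eq = recursion 𝔠 {𝒫 ℕ × 𝒫 ℕ} λ α prev → choose (em {∃ (Good (proj₁ ∘ prev) (proj₂ ∘ prev) α)})
        gen = proj₁ gen×eq
        gen-eq = proj₂ gen×eq

      -- Positivity of the generated family.

      module Generated (gen : ∣ 𝔠 ∣ → 𝒫 ℕ × 𝒫 ℕ)
                       (gen-good : ∀ α → PositiveBelow gen α → GoodAt gen α) where
        open Cardinal 𝔠 using () renaming (_<_ to _≺𝔠_; <-wellFounded to ≺𝔠-wellFounded)
        open IsStrictTotalOrder (Cardinal.isStrictTotalOrder 𝔠) using (compare) renaming (trans to ≺𝔠-trans)

        e x : ∣ 𝔠 ∣ → 𝒫 ℕ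
        e = proj₁ ∘ gen
        x = proj₂ ∘ gen

        _≼𝔠_ : ∣ 𝔠 ∣ → ∣ 𝔠 ∣ → Set
        β ≼𝔠 γ = β ≺𝔠 γ ⊎ β ≡ γ

        ≺≼-trans : ∀ {β γ δ} → β ≺𝔠 γ → γ ≼𝔠 δ → β ≺𝔠 δ
        ≺≼-trans β≺γ (inj₁ γ≺δ)  = ≺𝔠-trans β≺γ γ≺δ
        ≺≼-trans β≺γ (inj₂ refl) = β≺γ

        maximum : ∀ xs → xs ≡ [] ⊎ ∃ λ β → β List.∈ xs × All (_≼𝔠 β) xs
        maximum []       = inj₁ refl
        maximum (γ ∷ xs) with maximum xs
        ... | inj₁ refl = inj₂ (γ , here refl , inj₂ refl ∷ [])
        ... | inj₂ (β , β∈xs , xs≼β) with compare γ β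
        ... | tri< γ≺β _ _ = inj₂ (β , there β∈xs , inj₁ γ≺β ∷ xs≼β)
        ... | tri≈ _ γ≡β _ = inj₂ (β , there β∈xs , inj₂ γ≡β ∷ xs≼β)
        ... | tri> _ _ β≺γ = inj₂ (γ , here refl , inj₂ refl ∷ All.map (λ δ≼β → inj₁ (≼≺-trans δ≼β)) xs≼β)
          where
          ≼≺-trans : ∀ {δ} → δ ≼𝔠 β → δ ≺𝔠 γ
          ≼≺-trans (inj₁ δ≺β)  = ≺𝔠-trans δ≺β β≺γ
          ≼≺-trans (inj₂ refl) = β≺γ

        below : ∀ β → List ∣ 𝔠 ∣ → List (seg 𝔠 β)
        below β []       = []
        below β (γ ∷ xs) with compare γ β
        ... | tri< γ≺β _ _ = (γ , γ≺β) ∷ below β xs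
        ... | tri≈ _ _ _   = below β xs
        ... | tri> _ _ _   = below β xs

        ∈-below⁺ : ∀ β {γ} xs → γ List.∈ xs → γ ≺𝔠 β → ∃ λ γ≺β → (γ , γ≺β) List.∈ below β xs
        ∈-below⁺ β (δ ∷ xs) γ∈ γ≺β with compare δ β | γ∈
        ... | tri< δ≺β _ _ | here refl = δ≺β , here refl
        ... | tri< _ _ _   | there γ∈xs = let p , p∈ = ∈-below⁺ β xs γ∈xs γ≺β in p , there p∈
        ... | tri≈ ≮ _ _   | here refl = ⊥-elim (≮ γ≺β)
        ... | tri≈ _ _ _   | there γ∈xs = ∈-below⁺ β xs γ∈xs γ≺β
        ... | tri> ≮ _ _   | here refl = ⊥-elim (≮ γ≺β)
        ... | tri> _ _ _   | there γ∈xs = ∈-below⁺ β xs γ∈xs γ≺β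

        lower : {P : ∣ 𝔠 ∣ → Set} → ∀ β xs → All P xs → All (P ∘ proj₁) (below β xs)
        lower β []       []       = []
        lower β (γ ∷ xs) (p ∷ ps) with compare γ β
        ... | tri< _ _ _ = p ∷ lower β xs ps
        ... | tri≈ _ _ _ = lower β xs ps
        ... | tri> _ _ _ = lower β xs ps

        raise : {P : ∣ 𝔠 ∣ → Set} → ∀ β xs → (∀ {γ} → γ List.∈ xs → γ ≺𝔠 β ⊎ P γ) →
                All (P ∘ proj₁) (below β xs) → All P xs
        raise {P} β xs cases all = tabulate λ γ∈ → aux γ∈ (cases γ∈)
          where
          aux : ∀ {γ} → γ List.∈ xs → γ ≺𝔠 β ⊎ P γ → P γ
          aux γ∈ (inj₁ γ≺β) = lookup all (proj₂ (∈-below⁺ β xs γ∈ γ≺β))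
          aux γ∈ (inj₂ p)   = p

        -- By trichotomy this is γ ≼ i. Lists of such indices are left to `base`, higher ones to
        -- splitting.
        Low : List ∣ 𝔠 ∣ → ∣ 𝔠 ∣ → Set
        Low u γ = ∃ λ i → i List.∈ u × ¬ i ≺𝔠 γ

        module _ (u : List ∣ 𝔠 ∣) (N : 𝒫 ∣ 𝔠 ∣)
                 (base : ∀ τ → All (Low u) τ → Avoids N τ → Inf (R e x u τ)) where

          Claim : List ∣ 𝔠 ∣ → Set
          Claim τ = All (GoodAt gen) τ → Avoids N τ → Inf (R e x u τ)

          -- Let γ be the largest index in `τ`. If it is low, all of `τ` is. Otherwise `u` lies
          -- below γ, and `x γ` splits the set that is infinite by induction.
          claim-step : ∀ τ → (∀ γ → γ List.∈ τ → (τ′ : List (seg 𝔠 γ)) → Claim (map proj₁ τ′)) → Claim τ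
          claim-step τ IH good avoids with maximum τ
          ... | inj₁ refl = base [] [] []
          ... | inj₂ (γ , γ∈τ , τ≼γ) with em {Low u γ}
          ... | yes (i , i∈u , i⊀γ) =
            base τ (All.map (λ δ≼γ → i , i∈u , λ i≺δ → i⊀γ (≺≼-trans i≺δ δ≼γ)) τ≼γ) avoids
          ... | no ¬low = Inf-map up (Good.splits (lookup good γ∈τ) (below γ u) (below γ τ)
                            (Inf-map down (IH γ γ∈τ (below γ τ) (AllP.map⁺ (lower γ τ good)) (AllP.map⁺ (lower γ τ avoids)))))
            where
            down : ∀ m → R e x u (map proj₁ (below γ τ)) m → R (e ∘ proj₁) (x ∘ proj₁) (below γ u) (below γ τ) m
            down m (all , out) = lower γ u all , AllP.map⁻ out
            up : ∀ m → R (e ∘ proj₁) (x ∘ proj₁) (below γ u) (below γ τ) m × ¬ m ∈ x γ → R e x u τ m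
            up m ((all , out) , m∉xγ) =
              raise γ u (λ {i} i∈u → inj₁ (by-contradiction λ i⊀γ → ¬low (i , i∈u , i⊀γ))) all ,
              raise γ τ (λ δ∈τ → outside (lookup τ≼γ δ∈τ)) out
              where
              outside : ∀ {δ} → δ ≼𝔠 γ → δ ≺𝔠 γ ⊎ ¬ m ∈ x δ
              outside (inj₁ δ≺γ)  = inj₁ δ≺γ
              outside (inj₂ refl) = inj₂ m∉xγ

          -- Well-founded induction on a strict bound for the indices in `τ`.
          claim-below : ∀ γ → Acc _≺𝔠_ γ → (τ : List (seg 𝔠 γ)) → Claim (map proj₁ τ)
          claim-below γ (acc rs) τ = claim-step (map proj₁ τ) λ δ δ∈ →
            let (_ , δ≺γ) , _ , δ≡ = ∈-map⁻ proj₁ δ∈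
            in claim-below δ (rs (subst (_≺𝔠 γ) (sym δ≡) δ≺γ))

          claim : ∀ τ → Claim τ
          claim τ = claim-step τ λ γ _ → claim-below γ (≺𝔠-wellFounded γ)

        -- The largest index β of u provides N, since e β meets everything
        -- below; indices in τ above β are handled by splitting.
        good⇒positive : ∀ u → All (GoodAt gen) u → ∃ λ N → Few (Elements N) ×
                        (∀ τ → All (GoodAt gen) τ → Avoids N τ → Inf (R e x u τ))
        good⇒positive u good with maximum u
        ... | inj₁ refl = ∅ , Few-↣ {Y = ⊤} (mk↣ {to = λ ()} λ { {()} }) Few-⊤ , claim [] ∅ base
          where
          base : ∀ τ → All (Low []) τ → Avoids ∅ τ → Inf (R e x [] τ)
          base []      _                  _ n = n , ℕ.≤-refl , [] , []
          base (_ ∷ _) ((_ , () , _) ∷ _)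
        ... | inj₂ (β , β∈u , u≼β) with Good.meets (lookup good β∈u) (below β u)
        ... | N₀ , few₀ , inf = ⟦ N ⟧ , Few-↣ (mk↣ into-injective) (Few-⊎ Few-⊤ few₀) , claim u ⟦ N ⟧ base
          where
          -- β itself must be excluded because `e β` is contained in `x β`.
          N : ∣ 𝔠 ∣ → Set
          N γ = γ ≡ β ⊎ Σ (γ ≺𝔠 β) λ γ≺β → (γ , γ≺β) ∈ N₀
          sort : ∀ {γ} → N γ → ⊤ ⊎ Elements N₀
          sort (inj₁ _)             = inj₁ tt
          sort {γ} (inj₂ (γ≺β , γ∈)) = inj₂ ((γ , γ≺β) , γ∈)
          sort-injective : ∀ {γ δ} (p : N γ) (q : N δ) → sort p ≡ sort q → γ ≡ δ
          sort-injective (inj₁ refl) (inj₁ refl) _    = refl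
          sort-injective (inj₂ _)    (inj₂ _)    refl = refl
          into : Elements ⟦ N ⟧ → ⊤ ⊎ Elements N₀
          into (γ , γ∈) = sort (∈⟦⟧⁻ N γ∈)
          into-injective : ∀ {p q} → into p ≡ into q → p ≡ q
          into-injective {_ , p} {_ , q} eq = Elements-≡ (sort-injective (∈⟦⟧⁻ N p) (∈⟦⟧⁻ N q) eq)
          low⇒≺ : ∀ {γ} → Low u γ → ¬ γ ∈ ⟦ N ⟧ → γ ≺𝔠 β
          low⇒≺ {γ} (i , i∈u , i⊀γ) γ∉N with compare γ β
          ... | tri< γ≺β _ _ = γ≺β
          ... | tri≈ _ γ≡β _ = ⊥-elim (γ∉N (∈⟦⟧⁺ N (inj₁ γ≡β)))
          ... | tri> _ _ β≺γ with lookup u≼β i∈u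
          ... | inj₁ i≺β  = ⊥-elim (i⊀γ (≺𝔠-trans i≺β β≺γ))
          ... | inj₂ refl = ⊥-elim (i⊀γ β≺γ)
          base : ∀ τ → All (Low u) τ → Avoids ⟦ N ⟧ τ → Inf (R e x u τ)
          base τ low avoids = Inf-map up (inf (below β τ) (All.map (λ {q} out q∈ →
              out (∈⟦⟧⁺ N (inj₂ (proj₂ q , q∈)))) (lower β τ avoids)))
            where
            up : ∀ m → R (e ∘ proj₁) (x ∘ proj₁) (below β u) (below β τ) m × m ∈ e β → R e x u τ m
            up m ((all , out) , m∈eβ) =
              raise β u (λ i∈u → inside (lookup u≼β i∈u)) all ,
              raise β τ (λ γ∈τ → inj₁ (low⇒≺ (lookup low γ∈τ) (lookup avoids γ∈τ))) out
              where
              inside : ∀ {i} → i ≼𝔠 β → i ≺𝔠 β ⊎ m ∈ e i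
              inside (inj₁ i≺β)  = inj₁ i≺β
              inside (inj₂ refl) = inj₂ m∈eβ

        restrict-Few : ∀ {α N} → Few (Elements N) → Few (Elements {seg 𝔠 α} (N ∘ proj₁))
        restrict-Few = Few-↣ (mk↣ {to = λ ((β , _) , β∈N) → β , β∈N} λ eq →
          Elements-≡ (Σ-irrelevant-≡ (Cardinal.<-irrelevant 𝔠) (cong proj₁ eq)))

        -- By induction: goodness of the earlier stages gives positivity below α, hence goodness at
        -- α.
        good : ∀ α → GoodAt gen α
        good α = good-acc α (≺𝔠-wellFounded α)
          where
          good-acc : ∀ α → Acc _≺𝔠_ α → GoodAt gen α
          good-acc α (acc rs) = gen-good α λ u →
            let N , few , inf = good⇒positive (map proj₁ u) (all-good u)
            in N ∘ proj₁ , restrict-Few {α} {N} few , λ τ avoids →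
               Inf-map (λ m (all , out) → AllP.map⁻ all , AllP.map⁻ out)
                       (inf (map proj₁ τ) (all-good τ) (AllP.map⁺ avoids))
            where
            all-good : ∀ (u : List (seg 𝔠 α)) → All (GoodAt gen) (map proj₁ u)
            all-good u = AllP.map⁺ (All.universal (λ (β , β≺α) → good-acc β (rs β≺α)) u)

        positive : Positive e x
        positive u = let N , few , inf = good⇒positive u (All.universal good u)
                     in N , few , λ τ → inf τ (All.universal good τ)

        -- The ultrafilter.

        InFilter : 𝒫 ℕ → Set
        InFilter A = ∃ λ α → e α ⊆ A

        𝒰 : 𝒫 (𝒫 ℕ)
        𝒰 = ⟦ InFilter ⟧

        e∈𝒰 : ∀ α → e α ∈ 𝒰
        e∈𝒰 α = ∈⟦⟧⁺ InFilter (α , λ _ → id)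

        x∈𝒰 : ∀ α → x α ∈ 𝒰
        x∈𝒰 α = ∈⟦⟧⁺ InFilter (α , Good.below (good α))

        full∈𝒰 : (λ _ → true) ∈ 𝒰
        full∈𝒰 = ∈⟦⟧⁺ InFilter (to 𝒫ℕ↣𝔠 ∅ , λ _ _ → tt)

        e-centered : ∀ u → Inf (λ m → All (λ i → m ∈ e i) u)
        e-centered u = Inf-map (λ _ → proj₁) (proj₂ (proj₂ (positive u)) [] [])

        decided : ∀ A → ∃ λ α → e α ⊆ A ⊎ e α ⊆ ∁ A
        decided A = let α , αA = Bijection.strictlySurjective 𝔠⤖𝒫ℕ A
                    in α , subst (λ A → e α ⊆ A ⊎ e α ⊆ ∁ A) αA (Good.decides (good α))

        isUltrafilter : IsUltrafilter 𝒰
        isUltrafilter = record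
          { ∅∉       = λ ∅∈ → let α , eα⊆ = ∈⟦⟧⁻ InFilter ∅∈
                                  m , _ , m∈ = e-centered (α ∷ []) 0
                              in eα⊆ m (All.head m∈)
          ; upward   = λ A B A⊆B A∈ → let α , eα⊆ = ∈⟦⟧⁻ InFilter A∈
                                      in ∈⟦⟧⁺ InFilter (α , λ m → A⊆B m ∘ eα⊆ m)
          ; ∩-closed = λ A B A∈ B∈ → meet A B (∈⟦⟧⁻ InFilter A∈) (∈⟦⟧⁻ InFilter B∈) (decided (A ∩ B))
          ; ultra    = λ A → either A (decided A)
          }
          where
          -- Some `e γ` decides `A ∩ B`, and a common point of three generators rules out the
          -- complement.
          meet : ∀ A B → InFilter A → InFilter B → (∃ λ γ → e γ ⊆ A ∩ B ⊎ e γ ⊆ ∁ (A ∩ B)) → A ∩ B ∈ 𝒰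
          meet A B _         _         (γ , inj₁ eγ⊆) = ∈⟦⟧⁺ InFilter (γ , eγ⊆)
          meet A B (α , eα⊆) (β , eβ⊆) (γ , inj₂ eγ⊆) with e-centered (α ∷ β ∷ γ ∷ []) 0
          ... | m , _ , mα ∷ mβ ∷ mγ ∷ [] =
            ⊥-elim (∈-∁⁻ (A ∩ B) (eγ⊆ m mγ) (∈-∩⁺ A B (eα⊆ m mα) (eβ⊆ m mβ)))
          either : ∀ A → (∃ λ α → e α ⊆ A ⊎ e α ⊆ ∁ A) → A ∈ 𝒰 ⊎ ∁ A ∈ 𝒰
          either A (α , inj₁ eα⊆) = inj₁ (∈⟦⟧⁺ InFilter (α , eα⊆))
          either A (α , inj₂ eα⊆) = inj₂ (∈⟦⟧⁺ InFilter (α , eα⊆))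

        -- A singleton in `𝒰` would contain some `e α`, which is infinite.
        nonprincipal : Nonprincipal 𝒰
        nonprincipal (n , principal)
          with ∈⟦⟧⁻ InFilter (Equivalence.from (principal ⟦ n ≡_ ⟧) (∈⟦⟧⁺ (n ≡_) refl))
        ... | α , eα⊆ with e-centered (α ∷ []) (suc n)
        ... | m , n<m , m∈ ∷ [] = ℕ.<-irrefl (∈⟦⟧⁻ (n ≡_) (eα⊆ m m∈)) n<m

        -- Lower bounds of few members, and the few `x β` above a member.

        segment-bound : (t : Task) → (∀ ζ → proj₂ t ζ ∈ 𝒰) → ∃ λ α → ∀ ζ → proj₂ t ζ ⊇* e α
        segment-bound (η , h) h∈𝒰 = α , λ ζ → Ev⇒⊇* (h ζ) (e α) (Good.task (good α) (η , h) refl pos ζ)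
          where
          α = to Task↣𝔠 (η , h)
          -- The generator inside `h ζ` may come after stage α, so positivity of the whole family is
          -- used.
          witness : seg 𝔠 α ⊎ seg κ η → ∣ 𝔠 ∣
          witness (inj₁ (β , _)) = β
          witness (inj₂ ζ)       = proj₁ (∈⟦⟧⁻ InFilter (h∈𝒰 ζ))
          witness-⊆ : ∀ i → e (witness i) ⊆ [ e ∘ proj₁ , h ]′ i
          witness-⊆ (inj₁ _) m = id
          witness-⊆ (inj₂ ζ)   = proj₂ (∈⟦⟧⁻ InFilter (h∈𝒰 ζ))
          pos : Positive [ e ∘ proj₁ , h ]′ (x ∘ proj₁)
          pos u = let N , few , inf = positive (map witness u)
                  in N ∘ proj₁ , restrict-Few {α} {N} few , λ τ avoids →
                     Inf-map (λ m (all , out) → All.map (λ {i} → witness-⊆ i m) (AllP.map⁻ all) , AllP.map⁻ out)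
                             (inf (map proj₁ τ) (AllP.map⁺ avoids))

        bound : {I : Set} → Few I → (A : I → 𝒫 ℕ) → (∀ i → A i ∈ 𝒰) → ∃ λ α → ∀ i → A i ⊇* e α
        bound {I} few A A∈𝒰 = from (Few⇒↣seg few)
          where
          from : (∃ λ ξ → I ↣ seg κ ξ) → ∃ λ α → ∀ i → A i ⊇* e α
          from (ξ , ι) = let α , le = segment-bound (ξ , λ ζ → pick (em {Hit ζ})) (λ ζ → pick∈𝒰 em)
                         in α , λ i → subst (_⊇* e α) (pick-hit i em) (le (to ι i))
            where
            Hit : seg κ ξ → Set
            Hit ζ = ∃ λ i → to ι i ≡ ζ
            pick : ∀ {ζ} → Dec (Hit ζ) → 𝒫 ℕ
            pick (yes (i , _)) = A i
            -- Places outside the range of `ι` are padded with ℕ.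
            pick (no _)        = λ _ → true
            pick∈𝒰 : ∀ {ζ} (d : Dec (Hit ζ)) → pick d ∈ 𝒰
            pick∈𝒰 (yes (i , _)) = A∈𝒰 i
            pick∈𝒰 (no _)        = full∈𝒰
            pick-hit : ∀ i (d : Dec (Hit (to ι i))) → pick d ≡ A i
            pick-hit i (yes (i′ , eq)) = cong A (injective ι eq)
            pick-hit i (no none)       = ⊥-elim (none (i , refl))

        -- For `e α ⊆ A` and β outside the `N` of α, infinitely much of `e α` lies outside `x β`, so
        -- `x β` does not almost contain `A`.
        few-above : ∀ A → A ∈ 𝒰 → Few (Elements ⟦ (λ β → x β ⊇* A) ⟧)
        few-above A A∈𝒰 = from (proj₂ (∈⟦⟧⁻ InFilter A∈𝒰)) (positive (_ ∷ []))
          where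
          from : ∀ {α} → e α ⊆ A → (∃ λ N → Few (Elements N) × (∀ τ → Avoids N τ → Inf (R e x (α ∷ []) τ))) →
                 Few (Elements ⟦ (λ β → x β ⊇* A) ⟧)
          from {α} eα⊆ (N , few , inf) =
            Few-↣ (mk↣ {to = λ (β , β∈) → β , above⊆N β β∈} λ eq → Elements-≡ (cong proj₁ eq)) few
            where
            above⊆N : ⟦ (λ β → x β ⊇* A) ⟧ ⊆ N
            above⊆N β β∈ = by-contradiction λ β∉N →
              let m , _ , (m∈eα , m∉xβ) , m∈A⇒m∈xβ =
                    Inf-Ev (inf (β ∷ []) (β∉N ∷ [])) (⊇*⇒Ev (x β) A (∈⟦⟧⁻ (λ β → x β ⊇* A) β∈)) 0
              in All.head m∉xβ (m∈A⇒m∈xβ (eα⊆ m (All.head m∈eα)))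

        -- The Tukey maps.

        PU PC : Quasiorder
        PU = ⟨ 𝒰 ,⊇*⟩
        PC = ⟨[ 𝔠 ]^< κ ,⊆⟩

        few-set : (s : 𝒫 ∣ 𝔠 ∣) → Few (Elements s) → Preorder.Carrier PC
        few-set s few = s , from (Few⇒↣seg few) , few
          where
          from : (∃ λ ξ → Elements s ↣ seg κ ξ) → Elements s ↣ ∣ κ ∣
          from (ξ , ι) = seg↣ κ ξ ↣-∘ ι

        𝒰-directed : Directed PU
        𝒰-directed = binary⇒Directed PU (_ , full∈𝒰) λ (A , A∈) (B , B∈) →
          (A ∩ B , IsUltrafilter.∩-closed isUltrafilter A B A∈ B∈) ,
          Ev⇒⊇* A (A ∩ B) (0 , λ m _ m∈ → proj₁ (∈-∩⁻ A B m∈)) ,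
          Ev⇒⊇* B (A ∩ B) (0 , λ m _ m∈ → proj₂ (∈-∩⁻ A B m∈))

        []^<-directed : Directed PC
        []^<-directed = binary⇒Directed PC (few-set ∅ (Few-↣ {Y = ⊤} (mk↣ {to = λ ()} λ { {()} }) Few-⊤))
          λ (s , _ , fs) (t , _ , ft) →
          few-set ⟦ Union s t ⟧ (Few-⋃ Few-Bool (λ b → if b then s else t) λ { true → fs ; false → ft }) ,
          (λ β β∈ → ∈⟦⟧⁺ (Union s t) (true , β∈)) , (λ β β∈ → ∈⟦⟧⁺ (Union s t) (false , β∈))
          where
          Union : 𝒫 ∣ 𝔠 ∣ → 𝒫 ∣ 𝔠 ∣ → ∣ 𝔠 ∣ → Set
          Union s t β = ∃ λ b → β ∈ (if b then s else t)

        -- If `A` bounds the images of `S`, every β in a member of `S` has `x β ⊇* A`; by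
        -- `few-above` these β form a bound of `S`.
        []^<≤T𝒰 : PC ≤T PU
        []^<≤T𝒰 = []^<-directed , 𝒰-directed , (λ s → e (proj₁ (f s)) , e∈𝒰 _) , tukey
          where
          f : (s : Preorder.Carrier PC) → ∃ λ α → ∀ i → x (proj₁ i) ⊇* e α
          f (s , _ , few) = bound {Elements s} few (x ∘ proj₁) (x∈𝒰 ∘ proj₁)
          tukey : IsTukey PC PU (λ s → e (proj₁ (f s)) , e∈𝒰 _)
          tukey S unbounded ((A , A∈𝒰) , above) = unbounded (few-set _ (few-above A A∈𝒰) , λ s s∈S β β∈s →
            ∈⟦⟧⁺ (λ β → x β ⊇* A) (⊇*-trans (x β) _ A (proj₂ (f s) (β , β∈s)) (above _ (s , s∈S , refl))))

        -- If `t` contains the codes of all members of `S`, these are fewer than κ sets, so `bound`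
        -- gives them a common bound.
        𝒰≤T[]^< : PU ≤T PC
        𝒰≤T[]^< = 𝒰-directed , []^<-directed , g , tukey
          where
          code : Elements 𝒰 → ∣ 𝔠 ∣
          code (A , _) = to 𝒫ℕ↣𝔠 A
          g : Elements 𝒰 → Preorder.Carrier PC
          g a = few-set ⟦ code a ≡_ ⟧ (Few-↣ (mk↣ {to = λ _ → tt} λ { {β , β∈} {γ , γ∈} _ →
            Elements-≡ (trans (sym (∈⟦⟧⁻ (code a ≡_) β∈)) (∈⟦⟧⁻ (code a ≡_) γ∈)) }) Few-⊤)
          tukey : IsTukey PU PC g
          tukey S unbounded ((t , _ , few) , above) =
            let α , le = bound {Elements t} few (λ (β , _) → pick (em {Hit β})) (λ _ → pick∈𝒰 em)
            in unbounded ((e α , e∈𝒰 α) , λ a a∈S → subst (_⊇* e α) (pick-hit a a∈S em)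
                 (le (code a , above (g a) (a , a∈S , refl) (code a) (∈⟦⟧⁺ (code a ≡_) refl))))
            where
            Hit : ∣ 𝔠 ∣ → Set
            Hit β = ∃ λ a → S a × code a ≡ β
            pick : ∀ {β} → Dec (Hit β) → 𝒫 ℕ
            pick (yes ((A , _) , _)) = A
            -- Elements of `t` that code no member of `S` stand for ℕ.
            pick (no _)              = λ _ → true
            pick∈𝒰 : ∀ {β} (d : Dec (Hit β)) → pick d ∈ 𝒰
            pick∈𝒰 (yes ((_ , A∈) , _)) = A∈
            pick∈𝒰 (no _)               = full∈𝒰
            pick-hit : ∀ a → S a → (d : Dec (Hit (code a))) → pick d ≡ proj₁ a
            pick-hit a a∈S (yes (_ , _ , eq)) = injective 𝒫ℕ↣𝔠 eq
            pick-hit a a∈S (no none)          = ⊥-elim (none (a , a∈S , refl))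

theorem3p18 : ExcludedMiddle 0ℓ → Extensionality 0ℓ 0ℓ →
    (𝔠 : Cardinal) → ∣ 𝔠 ∣ ⤖ 𝒫 ℕ →
    Is𝔭 𝔠 →
    (κ : Cardinal) → ℕ ↣ ∣ κ ∣ → IsCofinality κ κ → ∣ κ ∣ ↣ ∣ 𝔠 ∣ →
    ∃ λ (𝒰 : 𝒫 (𝒫 ℕ)) →
    IsUltrafilter 𝒰 × Nonprincipal 𝒰 × (⟨ 𝒰 ,⊇*⟩ ≡T ⟨[ 𝔠 ]^< κ ,⊆⟩)
theorem3p18 em ext 𝔠 𝔠⤖𝒫ℕ is𝔭 κ ℕ↣κ regular κ↣𝔠 =
  G.𝒰 , G.isUltrafilter , G.nonprincipal , G.𝒰≤T[]^< , G.[]^<≤T𝒰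
  where
  module C = Classical.Continuum.Construction em ext 𝔠 𝔠⤖𝒫ℕ is𝔭 κ ℕ↣κ regular κ↣𝔠
  module G = C.Generated (proj₁ C.generators) (proj₂ C.generators)
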